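{- In Twisted Type Theory (with directed univalence and directed function extensionality), let $A:\mathcal U$ be a type in the empty context. Then the two functors $Y,\bar Y:(A\to\mathsf{Set})\times A\to\mathsf{Set}$ given by $Y(F,a):=\mathsf{Nat}(\mathsf{Hom}_A(a,-),F)$ and $\bar Y(F,a):=Fa$ are naturally isomorphic. That is, there are derivable terms $\Phi:\mathsf{Nat}(Y,\bar Y)$ and $\Psi:\mathsf{Nat}(\bar Y,Y)$ in the empty context, together with derivable terms $$F:A\to\mathsf{Set}\,.\,a:A\,.\,\varphi:Y(F,a)\vdash t:\mathsf{Hom}_{Y(F,a)}\big(\varphi,\Psi_{(F,a)}(\Phi_{(F,a)}(\varphi))\big),$$ $$F:A\to\mathsf{Set}\,.\,a:A\,.\,y:Fa\vdash s:\mathsf{Hom}_{Fa}\big(\Phi_{(F,a)}(\Psi_{(F,a)}(y)),y\big).$$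
   Context: Twisted Type Theory (TTT) consists of two copies of Martin-Löf type theory over the same contexts, each with structural rules (weakening, substitution, permutation): types $\Gamma\vdash A\,\mathsf{Ty}$, terms $\Gamma\vdash a:A$, extension $\Gamma.a:A$; and displayed types $\Gamma\vdash A\,\mathsf{Ty}_d$, terms $\Gamma\vdash a:_dA$, extension $\Gamma.^da:A$. $\diamond$ is the empty context. Rules: (Displayed) Every type is a displayed type and then $\Gamma.^da:A\equiv\Gamma.a:A$. (Opposites) From $\Gamma\vdash A\,\mathsf{Ty}$ infer $\Gamma\vdash A^{\mathrm{op}}\,\mathsf{Ty}$, with $(A^{\mathrm{op}})^{\mathrm{op}}\equiv A$. Every context $\Gamma$ has an opposite context $\Gamma^{\mathrm{op}}$, $(\Gamma^{\mathrm{op}})^{\mathrm{op}}\equiv\Gamma$, $\diamond^{\mathrm{op}}\equiv\diamond$. For $\Gamma^{\mathrm{op}}\vdash A\,\mathsf{Ty}$ write $\Gamma.^-a:A$ for $(\Gamma^{\mathrm{op}}.a:A^{\mathrm{op}})^{\mathrm{op}}$; for $A$ a closed type, $\Gamma.A\equiv\Gamma.^-A$. (Twist) From $\Gamma.b:B^{\mathrm{op}}\vdash C\,\mathsf{Ty}$ infer $\Gamma.b:B\vdash C[\bar b/b]\,\mathsf{Ty}_d$; if $C$ does not depend on $b$ then $C[\bar b/b]\equiv C$. Write $\Gamma.b:B.^{\mathrm{tw}}c:C[\bar b/b]$ for $\Gamma.b:B.^dc:C[\bar b/b]$, and $\Sigma^{\mathrm{tw}}_{b:B}C[\bar b/b]$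 for $(\Sigma_{b:B^{\mathrm{op}}}C^{\mathrm{op}})^{\mathrm{op}}$. (Universes) Universes $\mathcal U$ of types and $\mathsf{Set}$ of discrete types (indices implicit), discrete types being included in $\mathcal U$; $A^{\mathrm{op}}\equiv A$ for $A:\mathsf{Set}$. $\Pi$-types of families in $\mathsf{Set}$ are in $\mathsf{Set}$. ($\Sigma$) Strong $\Sigma$-types (pairing, projections, $\beta,\eta$) for $\Gamma\vdash A\,\mathsf{Ty}$, $\Gamma.a:A\vdash B\,\mathsf{Ty}$. Terms of $(\Sigma_{a:A}B)^{\mathrm{op}}$ correspond (by pairing and projections with $\beta,\eta$) to pairs of $\Gamma\vdash u:A^{\mathrm{op}}$ and $\Gamma\vdash v:_dB^{\mathrm{op}}[\bar u/a]$ (the substitution of $u$ in the twist $\Gamma.a:A^{\mathrm{op}}\vdash B^{\mathrm{op}}[\bar a/a]\,\mathsf{Ty}_d$). For $\Gamma\vdash X,Y\,\mathsf{Ty}$, $\Gamma.x:X.y:Y^{\mathrm{op}}\vdash Z\,\mathsf{Ty}$ there are mutually inverse operations $\mathsf{swap},\mathsf{swap}^{ -1}$ between terms of $(\Sigma_{x:X}\Sigma^{\mathrm{tw}}_{y:Y}Z(x,\bar y))^{\mathrm{op}}$ and of $\Sigma_{y:Y^{\mathrm{op}}}\Sigma^{\mathrm{tw}}_{x:X^{\mathrm{op}}}Z(\bar x,y)^{\mathrm{op}}$. ($\Pi$) For $\Gamma^{\mathrm{op}}\vdash A\,\mathsf{Ty}$ and $\Gamma.^-a:A\vdash B\,\mathsf{Ty}$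 there is $\Gamma\vdash\Pi_{a:A}B\,\mathsf{Ty}$, whose terms in context $\Gamma$ correspond by $\lambda$ and application ($\beta,\eta$) to terms $\Gamma.^-a:A\vdash b:B$. For $\Gamma\vdash A,B\,\mathsf{Ty}$, terms $\Gamma\vdash f:_d\bar A\to B$ of the twisted function type correspond likewise to terms $\Gamma.a:A\vdash b:B$. $X\to Y$, $X\times Y$ denote non-dependent $\Pi$, $\Sigma$. ($\mathsf{Hom}$) For $\Gamma\vdash A\,\mathsf{Ty}$: $\Gamma.b:A.a:A^{\mathrm{op}}\vdash\mathsf{Hom}_A(a,b):\mathsf{Set}$, and $\Gamma.a:A\vdash\mathsf{refl}_a:_d\mathsf{Hom}_A(\bar a,a)$. Elimination: given $\Gamma.a:A\vdash X\,\mathsf{Ty}$, $\Gamma.b:A.a:A.^{\mathrm{tw}}f:\mathsf{Hom}_A(\bar a,b).x:X^{\mathrm{op}}\vdash D\,\mathsf{Ty}$ and $\Gamma.a:A.x:X\vdash d:_dD[a/b,\mathsf{refl}_a/f,\bar x/x]$, one gets $\Gamma.b:A.a:A.^{\mathrm{tw}}f:\mathsf{Hom}_A(\bar a,b).x:X\vdash j(f,x,d):_dD[\bar x/x]$ with $j(\mathsf{refl}_a,x,d)\equiv d$. Directed univalence: for $\Gamma^{\mathrm{op}}\vdash A:\mathsf{Set}$, $\Gamma\vdash B:\mathsf{Set}$, $\Gamma\vdash(A\to B)\equiv\mathsf{Hom}_{\mathsf{Set}}(A,B):\mathsf{Set}$. Directed function extensionality: for $\Gamma\vdash F,G:\Pi_AB$,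 from a term of $\mathsf{Hom}_{Ba}(\overline{F(a)},G(a))$ in context $\Gamma.^-a:A$ one gets a term of $\mathsf{Hom}_{\Pi_AB}(\bar F,G)$ in context $\Gamma$. For $F,G$ copresheaves on $A$ (i.e. $a:A\vdash Fa,Ga:\mathsf{Set}$, possibly with parameters), $\mathsf{Nat}(F,G):=\prod_{(a,x):\sum_{a:A}Fa}Ga$; for $\varphi:\mathsf{Nat}(F,G)$ write $\varphi_a(x):=\varphi(a,x)$. In particular $Y(F,a)=\prod_{(x,f):\sum_{x:A}\mathsf{Hom}_A(a,x)}Fx$. Natural isomorphism between copresheaves $F,G$ on $A$ means a tuple $(\varphi,\psi,t,s)$ with $\varphi:\mathsf{Nat}(F,G)$, $\psi:\mathsf{Nat}(G,F)$, $a:A.x:Fa\vdash t:\mathsf{Hom}_{Fa}(x,\psi_a(\varphi_a(x)))$, $a:A.y:Ga\vdash s:\mathsf{Hom}_{Ga}(\varphi_a(\psi_a(y)),y)$. -}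

module Defs where

open import Data.Fin.Base using (Fin; zero; suc)
open import Data.Fin.Substitution using (Sub; Lift; TermSubst)
open import Data.Nat.Base using (ℕ; zero; suc; _+_; _≤_)
open import Data.Vec.Base using ([]; _∷_; lookup)

------------------------------------------------------------------------
-- Raw syntax

-- Twisted Type Theory is presented by well-scoped de Bruijn terms, with
-- derivability defined as an inductive family over them.  Types are terms
-- (universes are à la Russell).
--
-- `tw C u` is C[ū/b], the twist C[b̄/b] of a type C over b : Bᵒᵖ with the term
-- u : B substituted for b.  It binds b in C and is stable under substitution;
-- the twisted type over Γ . b : B itself is recovered by taking u to be the
-- variable b.
--
-- In `j f x d` the last argument binds a : A and x : X.
--
-- `pair`, `fst` and `snd` serve both Σ and its opposite; `lam` and `app` serve
-- both Π and the twisted function type.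

infix 30 _ᵒ

data Tm (n : ℕ) : Set where
  var             : Fin n → Tm n
  𝒰 𝒮et           : ℕ → Tm n
  _ᵒ              : Tm n → Tm n
  Π Σ             : Tm n → Tm (suc n) → Tm n
  lam             : Tm (suc n) → Tm n
  app pair        : Tm n → Tm n → Tm n
  fst snd         : Tm n → Tm n
  swap swap⁻¹     : Tm n → Tm n
  tw              : Tm (suc n) → Tm n → Tm n
  Hom             : Tm n → Tm n → Tm n → Tm n
  refl            : Tm n → Tm n
  j               : Tm n → Tm n → Tm (2 + n) → Tm n
  funext          : Tm (suc n) → Tm n

module TmApp {T : ℕ → Set} (l : Lift T Tm) where
  open Lift l hiding (var)

  infixl 8 _/_

  _/_ : ∀ {m n} → Tm m → Sub T m n → Tm n
  var x      / ρ = lift (lookup ρ x)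
  𝒰 i        / ρ = 𝒰 i
  𝒮et i      / ρ = 𝒮et i
  (A ᵒ)      / ρ = (A / ρ) ᵒ
  Π A B      / ρ = Π (A / ρ) (B / ρ ↑)
  Σ A B      / ρ = Σ (A / ρ) (B / ρ ↑)
  lam t      / ρ = lam (t / ρ ↑)
  app t u    / ρ = app (t / ρ) (u / ρ)
  pair t u   / ρ = pair (t / ρ) (u / ρ)
  fst t      / ρ = fst (t / ρ)
  snd t      / ρ = snd (t / ρ)
  swap t     / ρ = swap (t / ρ)
  swap⁻¹ t   / ρ = swap⁻¹ (t / ρ)
  tw C u     / ρ = tw (C / ρ ↑) (u / ρ)
  Hom A a b  / ρ = Hom (A / ρ) (a / ρ) (b / ρ)
  refl a     / ρ = refl (a / ρ)
  j f x d    / ρ = j (f / ρ) (x / ρ) (d / ρ ↑ ↑)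
  funext h   / ρ = funext (h / ρ ↑)

termSubst : TermSubst Tm
termSubst = record { var = var; app = TmApp._/_ }

open TermSubst termSubst public using (_/_; _⊙_; id; wk; sub; weaken)

private
  variable
    k m n     : ℕ

infix 31 _⁺

_⁺ : Tm n → Tm (suc n)
t ⁺ = weaken t

closed : Tm 0 → Tm n
closed A = A / []

x₀ : Tm (1 + n)
x₀ = var zero

x₁ : Tm (2 + n)
x₁ = var (suc zero)

x₂ : Tm (3 + n)
x₂ = var (suc (suc zero))

infixr 20 _⇒_
infixr 25 _×ᵗ_

_⇒_ : Tm n → Tm n → Tm n
A ⇒ B = Π A (B ⁺)

_×ᵗ_ : Tm n → Tm n → Tm n
A ×ᵗ B = Σ A (B ⁺)

-- Σᵗʷ_{b:B} C[b̄/b], for C over b : Bᵒᵖ.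
Σᵗʷ : Tm n → Tm (suc n) → Tm n
Σᵗʷ B C = (Σ (B ᵒ) (C ᵒ)) ᵒ

-- Hom_A(ā,b), for a : A and b : A.
Homᵗʷ : Tm n → Tm n → Tm n → Tm n
Homᵗʷ A a b = tw (Hom (A ⁺) x₀ (b ⁺)) a

-- Ā → B, for A and B over the same context: the twist along X : 𝒰 of X → B,
-- which is a type over X : 𝒰ᵒᵖ, with A substituted for X.
_⇒ᵗʷ_ : Tm n → Tm n → Tm n
A ⇒ᵗʷ B = tw (x₀ ⇒ (B ⁺)) A

-- Exchange of the last two variables.
exch : Tm (2 + n) → Tm (2 + n)
exch Z = Z / (x₁ ∷ x₀ ∷ wk ⊙ wk)

------------------------------------------------------------------------
-- Contexts

-- The two copies of the judgements, for types and for displayed types.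
data Mode : Set where
  std dsp : Mode

infixl 15 _▹[_]_ _▹_ _▹ᵈ_ _▹⁻_
infix  30 _ᵒᵖ

data Ctx : ℕ → Set where
  ◇       : Ctx 0
  _▹[_]_  : Ctx n → Mode → Tm n → Ctx (suc n)
  _ᵒᵖ     : Ctx n → Ctx n

_▹_ _▹ᵈ_ _▹⁻_ : Ctx n → Tm n → Ctx (suc n)
Γ ▹  A = Γ ▹[ std ] A
Γ ▹ᵈ A = Γ ▹[ dsp ] A
Γ ▹⁻ A = (Γ ᵒᵖ ▹ A ᵒ) ᵒᵖ

------------------------------------------------------------------------
-- Derivability

private
  variable
    μ                       : Mode
    i i′                    : ℕ
    Γ Γ′                    : Ctx n
    Δ Δ′                    : Ctx m
    Θ                       : Ctx k
    A A′ A″ B B′ X Y        : Tm n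
    C C′                    : Tm (suc n)
    Z                       : Tm (2 + n)
    D                       : Tm (4 + n)
    F G                     : Tm n
    a a′ b b′ f f′ s t t′ t″ u u′ v v′ x x′ : Tm n
    d d′                    : Tm (2 + n)
    h h′                    : Tm (suc n)
    σ σ′ σ″ τ τ′            : Sub Tm m n

-- The type of swap's argument, (Σ_{x:X} Σᵗʷ_{y:Y} Z(x,ȳ))ᵒᵖ, and of its result,
-- Σ_{y:Yᵒᵖ} Σᵗʷ_{x:Xᵒᵖ} Z(x̄,y)ᵒᵖ, for Z over x : X, y : Yᵒᵖ.
Swap₁ Swap₂ : Tm n → Tm n → Tm (2 + n) → Tm n
Swap₁ X Y Z = (Σ X (Σᵗʷ (Y ⁺) Z)) ᵒ
Swap₂ X Y Z = Σ (Y ᵒ) (Σᵗʷ ((X ᵒ) ⁺) (exch Z ᵒ))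

-- The context Γ . b:A . a:A . ᵗʷf:Hom_A(ā,b) . x:Xᵒᵖ of the motive of j, for X
-- over Γ . a:A.
MotiveCtx : Ctx n → Tm n → Tm (suc n) → Ctx (4 + n)
MotiveCtx Γ A X =
  Γ ▹ A ▹ A ⁺ ▹ᵈ Homᵗʷ (A ⁺ ⁺) x₀ x₁ ▹ (X / (x₁ ∷ wk ⊙ wk ⊙ wk)) ᵒ

-- D[x̄/x] at b, a, f, x, and at ρ for the variables of Γ.
motiveAt : Sub Tm n m → Tm (4 + n) → (b a f x : Tm m) → Tm m
motiveAt ρ D b a f x = tw (D / (x₀ ∷ f ⁺ ∷ a ⁺ ∷ b ⁺ ∷ ρ ⊙ wk)) x

-- Γ ⊢[ std ] A type i  and  Γ ⊢[ dsp ] A type i  are Γ ⊢ A Ty and Γ ⊢ A Ty_d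
-- for types of size i;  Γ ⊢[ std ] a ∶ A  and  Γ ⊢[ dsp ] a ∶ A  are Γ ⊢ a : A
-- and Γ ⊢ a :_d A.  Judgemental equality is written ≐.  Weakening and permutation
-- are instances of substitution, and since Γ .ᵈ a:A is Γ . a:A for an ordinary
-- type A, the ordinary and the displayed terms of A coincide.
--
-- The contexts Γ and Γᵒᵖ declare the same variables, and Γ . a:A and Γ .⁻ a:A
-- are identified, for closed A, together with their variable a.  Taking
-- opposites of contexts is functorial, and a substitution is sent to the
-- substitution with the same underlying terms.  In particular, for closed A, a
-- term a of A in context Γ is also a term a of Aᵒᵖ in context Γᵒᵖ; this is how
-- A : Set in Γᵒᵖ is an argument of Hom_Set in Γ.

infix 4 ⊢_ ⊢_≐_ _⊢_⇛_ _⊢_≐_⇛_ _⊢[_]_type_ _⊢[_]_≐_type_ _⊢[_]_∶_ _⊢[_]_≐_∶_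

data ⊢_ : Ctx n → Set
data ⊢_≐_ : Ctx n → Ctx n → Set
data _⊢_⇛_ : Ctx m → Sub Tm n m → Ctx n → Set
data _⊢_≐_⇛_ : Ctx m → Sub Tm n m → Sub Tm n m → Ctx n → Set
data _⊢[_]_type_ : Ctx n → Mode → Tm n → ℕ → Set
data _⊢[_]_≐_type_ : Ctx n → Mode → Tm n → Tm n → ℕ → Set
data _⊢[_]_∶_ : Ctx n → Mode → Tm n → Tm n → Set
data _⊢[_]_≐_∶_ : Ctx n → Mode → Tm n → Tm n → Tm n → Set

data ⊢_ where

  ◇-ctx : ⊢ ◇

  ▹-ctx : Γ ⊢[ μ ] A type i →
          -------------------
          ⊢ Γ ▹[ μ ] A

  ᵒᵖ-ctx : ⊢ Γ →
           ------
           ⊢ Γ ᵒᵖ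

data ⊢_≐_ where

  ctx-refl : ⊢ Γ →
             ---------
             ⊢ Γ ≐ Γ

  ctx-sym : ⊢ Γ ≐ Γ′ →
            ----------
            ⊢ Γ′ ≐ Γ

  ctx-trans : {Γ Γ′ Γ″ : Ctx n} →
              ⊢ Γ ≐ Γ′ →
              ⊢ Γ′ ≐ Γ″ →
              -----------
              ⊢ Γ ≐ Γ″

  ▹-cong : ⊢ Γ ≐ Γ′ →
           Γ ⊢[ μ ] A ≐ A′ type i →
           ----------------------------
           ⊢ Γ ▹[ μ ] A ≐ Γ′ ▹[ μ ] A′

  ᵒᵖ-cong : ⊢ Γ ≐ Γ′ →
            ----------------
            ⊢ Γ ᵒᵖ ≐ Γ′ ᵒᵖ

  ᵒᵖ-ᵒᵖ : ⊢ Γ →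
          ----------------
          ⊢ Γ ᵒᵖ ᵒᵖ ≐ Γ

  ◇-ᵒᵖ : ⊢ ◇ ᵒᵖ ≐ ◇

  ▹ᵈ-std : Γ ⊢[ std ] A type i →
           -----------------------
           ⊢ Γ ▹ᵈ A ≐ Γ ▹ A

  ▹⁻-closed : {A : Tm 0} →
              ⊢ Γ →
              ◇ ⊢[ std ] A type i →
              -------------------------------
              ⊢ Γ ▹ closed A ≐ Γ ▹⁻ closed A

data _⊢_⇛_ where

  ⇛-id : ⊢ Γ →
         ----------
         Γ ⊢ id ⇛ Γ

  ⇛-⊙ : {Γ : Ctx n} {Δ : Ctx m} {Θ : Ctx k}
        {σ : Sub Tm n m} {τ : Sub Tm m k} →
        Δ ⊢ σ ⇛ Γ →
        Θ ⊢ τ ⇛ Δ →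
        --------------
        Θ ⊢ σ ⊙ τ ⇛ Γ

  ⇛-wk : Γ ⊢[ μ ] A type i →
         --------------------
         Γ ▹[ μ ] A ⊢ wk ⇛ Γ

  ⇛-[] : ⊢ Γ →
         -----------
         Γ ⊢ [] ⇛ ◇

  ⇛-∷ : Δ ⊢ σ ⇛ Γ →
        Γ ⊢[ μ ] A type i →
        Δ ⊢[ μ ] t ∶ A / σ →
        -----------------------
        Δ ⊢ t ∷ σ ⇛ Γ ▹[ μ ] A

  ⇛-ᵒᵖ : Δ ⊢ σ ⇛ Γ →
         -----------------
         Δ ᵒᵖ ⊢ σ ⇛ Γ ᵒᵖ

  ⇛-conv : ⊢ Δ ≐ Δ′ →
           ⊢ Γ ≐ Γ′ →
           Δ ⊢ σ ⇛ Γ →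
           -------------
           Δ′ ⊢ σ ⇛ Γ′

data _⊢_≐_⇛_ where

  sub-refl : Δ ⊢ σ ⇛ Γ →
             --------------
             Δ ⊢ σ ≐ σ ⇛ Γ

  sub-sym : Δ ⊢ σ ≐ σ′ ⇛ Γ →
            ----------------
            Δ ⊢ σ′ ≐ σ ⇛ Γ

  sub-trans : Δ ⊢ σ ≐ σ′ ⇛ Γ →
              Δ ⊢ σ′ ≐ σ″ ⇛ Γ →
              -----------------
              Δ ⊢ σ ≐ σ″ ⇛ Γ

  ⊙-cong : {Γ : Ctx n} {Δ : Ctx m} {Θ : Ctx k}
           {σ σ′ : Sub Tm n m} {τ τ′ : Sub Tm m k} →
           Δ ⊢ σ ≐ σ′ ⇛ Γ →
           Θ ⊢ τ ≐ τ′ ⇛ Δ →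
           -------------------------
           Θ ⊢ σ ⊙ τ ≐ σ′ ⊙ τ′ ⇛ Γ

  ∷-cong : Δ ⊢ σ ≐ σ′ ⇛ Γ →
           Γ ⊢[ μ ] A type i →
           Δ ⊢[ μ ] t ≐ t′ ∶ A / σ →
           ---------------------------------
           Δ ⊢ t ∷ σ ≐ t′ ∷ σ′ ⇛ Γ ▹[ μ ] A

  sub-ᵒᵖ : Δ ⊢ σ ≐ σ′ ⇛ Γ →
           ----------------------
           Δ ᵒᵖ ⊢ σ ≐ σ′ ⇛ Γ ᵒᵖ

  sub-conv : ⊢ Δ ≐ Δ′ →
             ⊢ Γ ≐ Γ′ →
             Δ ⊢ σ ≐ σ′ ⇛ Γ →
             ------------------
             Δ′ ⊢ σ ≐ σ′ ⇛ Γ′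

data _⊢[_]_type_ where

  ty-ctx : ⊢ Γ ≐ Γ′ →
           Γ ⊢[ μ ] A type i →
           -------------------
           Γ′ ⊢[ μ ] A type i

  ty-sub : Γ ⊢[ μ ] A type i →
           Δ ⊢ σ ⇛ Γ →
           -----------------------
           Δ ⊢[ μ ] A / σ type i

  ty-lift : i ≤ i′ →
            Γ ⊢[ μ ] A type i →
            --------------------
            Γ ⊢[ μ ] A type i′

  ty-dsp : Γ ⊢[ std ] A type i →
           ---------------------
           Γ ⊢[ dsp ] A type i

  ty-𝒰 : ⊢ Γ →
         --------------------------
         Γ ⊢[ std ] 𝒰 i type suc i

  ty-𝒮et : ⊢ Γ →
           ----------------------------
           Γ ⊢[ std ] 𝒮et i type suc i

  ty-El : Γ ⊢[ std ] A ∶ 𝒰 i →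
          ---------------------
          Γ ⊢[ std ] A type i

  ty-ᵒ : Γ ⊢[ std ] A type i →
         -----------------------
         Γ ⊢[ std ] A ᵒ type i

  ty-Π : Γ ᵒᵖ ⊢[ std ] A type i →
         Γ ▹⁻ A ⊢[ std ] C type i →
         --------------------------
         Γ ⊢[ std ] Π A C type i

  ty-Σ : Γ ⊢[ std ] A type i →
         Γ ▹ A ⊢[ std ] C type i →
         -------------------------
         Γ ⊢[ std ] Σ A C type i

  ty-tw : Γ ⊢[ std ] B type i →
          Γ ▹ B ᵒ ⊢[ std ] C type i′ →
          Γ ⊢[ std ] u ∶ B →
          ----------------------------
          Γ ⊢[ dsp ] tw C u type i′

data _⊢[_]_≐_type_ where

  ty-refl : Γ ⊢[ μ ] A type i →
            -----------------------
            Γ ⊢[ μ ] A ≐ A type i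

  ty-sym : Γ ⊢[ μ ] A ≐ A′ type i →
           ------------------------
           Γ ⊢[ μ ] A′ ≐ A type i

  ty-trans : Γ ⊢[ μ ] A ≐ A′ type i →
             Γ ⊢[ μ ] A′ ≐ A″ type i →
             -------------------------
             Γ ⊢[ μ ] A ≐ A″ type i

  ty-ctx : ⊢ Γ ≐ Γ′ →
           Γ ⊢[ μ ] A ≐ A′ type i →
           ------------------------
           Γ′ ⊢[ μ ] A ≐ A′ type i

  ty-sub : Γ ⊢[ μ ] A ≐ A′ type i →
           Δ ⊢ σ ≐ σ′ ⇛ Γ →
           ---------------------------------
           Δ ⊢[ μ ] A / σ ≐ A′ / σ′ type i

  ty-lift : i ≤ i′ →
            Γ ⊢[ μ ] A ≐ A′ type i →
            ------------------------
            Γ ⊢[ μ ] A ≐ A′ type i′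

  ty-dsp : Γ ⊢[ std ] A ≐ A′ type i →
           ---------------------------
           Γ ⊢[ dsp ] A ≐ A′ type i

  ty-El : Γ ⊢[ std ] A ≐ A′ ∶ 𝒰 i →
          --------------------------
          Γ ⊢[ std ] A ≐ A′ type i

  ᵒ-cong : Γ ⊢[ std ] A ≐ A′ type i →
           -------------------------------
           Γ ⊢[ std ] A ᵒ ≐ A′ ᵒ type i

  ᵒ-ᵒ : Γ ⊢[ std ] A type i →
        ---------------------------
        Γ ⊢[ std ] A ᵒ ᵒ ≐ A type i

  ᵒ-𝒮et : Γ ⊢[ std ] A ∶ 𝒮et i →
          ---------------------------
          Γ ⊢[ std ] A ᵒ ≐ A type i

  Π-cong : Γ ᵒᵖ ⊢[ std ] A type i →
           Γ ᵒᵖ ⊢[ std ] A ≐ A′ type i →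
           Γ ▹⁻ A ⊢[ std ] C ≐ C′ type i →
           ------------------------------------
           Γ ⊢[ std ] Π A C ≐ Π A′ C′ type i

  Σ-cong : Γ ⊢[ std ] A type i →
           Γ ⊢[ std ] A ≐ A′ type i →
           Γ ▹ A ⊢[ std ] C ≐ C′ type i →
           ------------------------------------
           Γ ⊢[ std ] Σ A C ≐ Σ A′ C′ type i

  tw-cong : Γ ⊢[ std ] B type i →
            Γ ▹ B ᵒ ⊢[ std ] C ≐ C′ type i′ →
            Γ ⊢[ std ] u ≐ u′ ∶ B →
            --------------------------------------
            Γ ⊢[ dsp ] tw C u ≐ tw C′ u′ type i′

  tw-const : Γ ⊢[ std ] B type i →
             Γ ⊢[ std ] A type i′ →
             Γ ⊢[ std ] u ∶ B →
             -----------------------------------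
             Γ ⊢[ dsp ] tw (A ⁺) u ≐ A type i′

  -- For a discrete B = Bᵒᵖ, the variables b : B and b : Bᵒᵖ are the same, that
  -- is, b̄ is b.
  tw-𝒮et : Γ ⊢[ std ] B ∶ 𝒮et i →
           Γ ▹ B ᵒ ⊢[ std ] C type i′ →
           Γ ⊢[ std ] u ∶ B →
           ---------------------------------------
           Γ ⊢[ dsp ] tw C u ≐ C / sub u type i′

data _⊢[_]_∶_ where

  tm-ctx : ⊢ Γ ≐ Γ′ →
           Γ ⊢[ μ ] t ∶ A →
           ----------------
           Γ′ ⊢[ μ ] t ∶ A

  tm-conv : Γ ⊢[ μ ] A ≐ A′ type i →
            Γ ⊢[ μ ] t ∶ A →
            ------------------------
            Γ ⊢[ μ ] t ∶ A′

  tm-sub : Γ ⊢[ μ ] t ∶ A →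
           Δ ⊢ σ ⇛ Γ →
           ------------------------
           Δ ⊢[ μ ] t / σ ∶ A / σ

  tm-var : Γ ⊢[ μ ] A type i →
           ---------------------------
           Γ ▹[ μ ] A ⊢[ μ ] x₀ ∶ A ⁺

  tm-𝒰 : Γ ⊢[ std ] A type i →
         ----------------------
         Γ ⊢[ std ] A ∶ 𝒰 i

  tm-𝒮et-𝒰 : Γ ⊢[ std ] A ∶ 𝒮et i →
             ------------------------
             Γ ⊢[ std ] A ∶ 𝒰 i

  tm-𝒮et-lift : i ≤ i′ →
                Γ ⊢[ std ] A ∶ 𝒮et i →
                ------------------------
                Γ ⊢[ std ] A ∶ 𝒮et i′

  tm-Π-𝒮et : Γ ᵒᵖ ⊢[ std ] A type i →
             Γ ▹⁻ A ⊢[ std ] C ∶ 𝒮et i →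
             ----------------------------
             Γ ⊢[ std ] Π A C ∶ 𝒮et i

  tm-Hom : Γ ⊢[ std ] A type i →
           Γ ⊢[ std ] a ∶ A ᵒ →
           Γ ⊢[ std ] b ∶ A →
           ---------------------------
           Γ ⊢[ std ] Hom A a b ∶ 𝒮et i

  tm-lam : Γ ᵒᵖ ⊢[ std ] A type i →
           Γ ▹⁻ A ⊢[ std ] t ∶ C →
           -------------------------
           Γ ⊢[ std ] lam t ∶ Π A C

  tm-app : Γ ⊢[ std ] f ∶ Π A C →
           Γ ᵒᵖ ⊢[ std ] u ∶ A ᵒ →
           ------------------------------
           Γ ⊢[ std ] app f u ∶ C / sub u

  tm-lamᵗʷ : Γ ⊢[ std ] A type i →
             Γ ⊢[ std ] B type i →
             Γ ▹ A ⊢[ std ] t ∶ B ⁺ →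
             ---------------------------
             Γ ⊢[ dsp ] lam t ∶ A ⇒ᵗʷ B

  tm-appᵗʷ : Γ ⊢[ dsp ] f ∶ A ⇒ᵗʷ B →
             Γ ⊢[ std ] u ∶ A →
             ---------------------------
             Γ ⊢[ std ] app f u ∶ B

  tm-pair : Γ ▹ A ⊢[ std ] C type i →
            Γ ⊢[ std ] u ∶ A →
            Γ ⊢[ std ] v ∶ C / sub u →
            ---------------------------
            Γ ⊢[ std ] pair u v ∶ Σ A C

  tm-fst : Γ ⊢[ std ] t ∶ Σ A C →
           ------------------------
           Γ ⊢[ std ] fst t ∶ A

  tm-snd : Γ ⊢[ std ] t ∶ Σ A C →
           ----------------------------------
           Γ ⊢[ std ] snd t ∶ C / sub (fst t)

  tm-pairᵒ : Γ ▹ A ⊢[ std ] C type i →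
             Γ ⊢[ std ] u ∶ A ᵒ →
             Γ ⊢[ dsp ] v ∶ tw (C ᵒ) u →
             -------------------------------
             Γ ⊢[ std ] pair u v ∶ (Σ A C) ᵒ

  tm-fstᵒ : Γ ⊢[ std ] t ∶ (Σ A C) ᵒ →
            --------------------------
            Γ ⊢[ std ] fst t ∶ A ᵒ

  tm-sndᵒ : Γ ⊢[ std ] t ∶ (Σ A C) ᵒ →
            ------------------------------------
            Γ ⊢[ dsp ] snd t ∶ tw (C ᵒ) (fst t)

  tm-swap : Γ ⊢[ std ] X type i →
            Γ ⊢[ std ] Y type i →
            Γ ▹ X ▹ (Y ᵒ) ⁺ ⊢[ std ] Z type i →
            Γ ⊢[ std ] t ∶ Swap₁ X Y Z →
            -----------------------------------
            Γ ⊢[ std ] swap t ∶ Swap₂ X Y Z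

  tm-swap⁻¹ : Γ ⊢[ std ] X type i →
              Γ ⊢[ std ] Y type i →
              Γ ▹ X ▹ (Y ᵒ) ⁺ ⊢[ std ] Z type i →
              Γ ⊢[ std ] s ∶ Swap₂ X Y Z →
              -----------------------------------
              Γ ⊢[ std ] swap⁻¹ s ∶ Swap₁ X Y Z

  tm-refl : Γ ⊢[ std ] A type i →
            Γ ⊢[ std ] a ∶ A →
            ------------------------------
            Γ ⊢[ dsp ] refl a ∶ Homᵗʷ A a a

  tm-j : Γ ▹ A ⊢[ std ] X type i →
         MotiveCtx Γ A X ⊢[ std ] D type i′ →
         Γ ▹ A ▹ X ⊢[ dsp ] d ∶ motiveAt (wk ⊙ wk) D x₁ x₁ (refl x₁) x₀ →
         Γ ⊢[ std ] b ∶ A →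
         Γ ⊢[ std ] a ∶ A →
         Γ ⊢[ dsp ] f ∶ Homᵗʷ A a b →
         Γ ⊢[ std ] x ∶ X / sub a →
         -----------------------------------
         Γ ⊢[ dsp ] j f x d ∶ motiveAt id D b a f x

  tm-funext : Γ ᵒᵖ ⊢[ std ] A type i →
              Γ ▹⁻ A ⊢[ std ] C type i →
              Γ ⊢[ std ] F ∶ Π A C →
              Γ ⊢[ std ] G ∶ Π A C →
              Γ ▹⁻ A ⊢[ dsp ] h ∶ Homᵗʷ C (app (F ⁺) x₀) (app (G ⁺) x₀) →
              ------------------------------------------------------------
              Γ ⊢[ dsp ] funext h ∶ Homᵗʷ (Π A C) F G

data _⊢[_]_≐_∶_ where

  tm-≐-refl : Γ ⊢[ μ ] t ∶ A →
              --------------------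
              Γ ⊢[ μ ] t ≐ t ∶ A

  tm-≐-sym : Γ ⊢[ μ ] t ≐ t′ ∶ A →
             ---------------------
             Γ ⊢[ μ ] t′ ≐ t ∶ A

  tm-≐-trans : Γ ⊢[ μ ] t ≐ t′ ∶ A →
               Γ ⊢[ μ ] t′ ≐ t″ ∶ A →
               ----------------------
               Γ ⊢[ μ ] t ≐ t″ ∶ A

  tm-ctx : ⊢ Γ ≐ Γ′ →
           Γ ⊢[ μ ] t ≐ t′ ∶ A →
           ----------------------
           Γ′ ⊢[ μ ] t ≐ t′ ∶ A

  tm-conv : Γ ⊢[ μ ] A ≐ A′ type i →
            Γ ⊢[ μ ] t ≐ t′ ∶ A →
            ------------------------
            Γ ⊢[ μ ] t ≐ t′ ∶ A′

  tm-sub : Γ ⊢[ μ ] A type i →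
           Γ ⊢[ μ ] t ≐ t′ ∶ A →
           Δ ⊢ σ ≐ σ′ ⇛ Γ →
           ----------------------------------
           Δ ⊢[ μ ] t / σ ≐ t′ / σ′ ∶ A / σ

  tm-𝒰 : Γ ⊢[ std ] A ≐ A′ type i →
         ---------------------------
         Γ ⊢[ std ] A ≐ A′ ∶ 𝒰 i

  tm-𝒮et-𝒰 : Γ ⊢[ std ] A ≐ A′ ∶ 𝒮et i →
             ----------------------------
             Γ ⊢[ std ] A ≐ A′ ∶ 𝒰 i

  tm-𝒮et-lift : i ≤ i′ →
                Γ ⊢[ std ] A ≐ A′ ∶ 𝒮et i →
                ----------------------------
                Γ ⊢[ std ] A ≐ A′ ∶ 𝒮et i′

  Π-𝒮et-cong : Γ ᵒᵖ ⊢[ std ] A type i →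
               Γ ᵒᵖ ⊢[ std ] A ≐ A′ type i →
               Γ ▹⁻ A ⊢[ std ] C ≐ C′ ∶ 𝒮et i →
               -------------------------------------
               Γ ⊢[ std ] Π A C ≐ Π A′ C′ ∶ 𝒮et i

  Hom-cong : Γ ⊢[ std ] A ≐ A′ type i →
             Γ ⊢[ std ] a ≐ a′ ∶ A ᵒ →
             Γ ⊢[ std ] b ≐ b′ ∶ A →
             ---------------------------------------------
             Γ ⊢[ std ] Hom A a b ≐ Hom A′ a′ b′ ∶ 𝒮et i

  lam-cong : Γ ᵒᵖ ⊢[ std ] A type i →
             Γ ▹⁻ A ⊢[ std ] t ≐ t′ ∶ C →
             ----------------------------------
             Γ ⊢[ std ] lam t ≐ lam t′ ∶ Π A C

  app-cong : Γ ⊢[ std ] f ≐ f′ ∶ Π A C →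
             Γ ᵒᵖ ⊢[ std ] u ≐ u′ ∶ A ᵒ →
             -------------------------------------------
             Γ ⊢[ std ] app f u ≐ app f′ u′ ∶ C / sub u

  lamᵗʷ-cong : Γ ⊢[ std ] A type i →
               Γ ⊢[ std ] B type i →
               Γ ▹ A ⊢[ std ] t ≐ t′ ∶ B ⁺ →
               ------------------------------------
               Γ ⊢[ dsp ] lam t ≐ lam t′ ∶ A ⇒ᵗʷ B

  appᵗʷ-cong : Γ ⊢[ dsp ] f ≐ f′ ∶ A ⇒ᵗʷ B →
               Γ ⊢[ std ] u ≐ u′ ∶ A →
               -----------------------------------
               Γ ⊢[ std ] app f u ≐ app f′ u′ ∶ B

  pair-cong : Γ ▹ A ⊢[ std ] C type i →
              Γ ⊢[ std ] u ≐ u′ ∶ A →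
              Γ ⊢[ std ] v ≐ v′ ∶ C / sub u →
              ----------------------------------------
              Γ ⊢[ std ] pair u v ≐ pair u′ v′ ∶ Σ A C

  fst-cong : Γ ⊢[ std ] t ≐ t′ ∶ Σ A C →
             -------------------------------
             Γ ⊢[ std ] fst t ≐ fst t′ ∶ A

  snd-cong : Γ ⊢[ std ] t ≐ t′ ∶ Σ A C →
             --------------------------------------------
             Γ ⊢[ std ] snd t ≐ snd t′ ∶ C / sub (fst t)

  pairᵒ-cong : Γ ▹ A ⊢[ std ] C type i →
               Γ ⊢[ std ] u ≐ u′ ∶ A ᵒ →
               Γ ⊢[ dsp ] v ≐ v′ ∶ tw (C ᵒ) u →
               ---------------------------------------------
               Γ ⊢[ std ] pair u v ≐ pair u′ v′ ∶ (Σ A C) ᵒ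

  fstᵒ-cong : Γ ⊢[ std ] t ≐ t′ ∶ (Σ A C) ᵒ →
              ---------------------------------
              Γ ⊢[ std ] fst t ≐ fst t′ ∶ A ᵒ

  sndᵒ-cong : Γ ⊢[ std ] t ≐ t′ ∶ (Σ A C) ᵒ →
              ----------------------------------------------
              Γ ⊢[ dsp ] snd t ≐ snd t′ ∶ tw (C ᵒ) (fst t)

  swap-cong : Γ ⊢[ std ] X type i →
              Γ ⊢[ std ] Y type i →
              Γ ▹ X ▹ (Y ᵒ) ⁺ ⊢[ std ] Z type i →
              Γ ⊢[ std ] t ≐ t′ ∶ Swap₁ X Y Z →
              --------------------------------------------
              Γ ⊢[ std ] swap t ≐ swap t′ ∶ Swap₂ X Y Z

  swap⁻¹-cong : Γ ⊢[ std ] X type i →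
                Γ ⊢[ std ] Y type i →
                Γ ▹ X ▹ (Y ᵒ) ⁺ ⊢[ std ] Z type i →
                Γ ⊢[ std ] t ≐ t′ ∶ Swap₂ X Y Z →
                ----------------------------------------------
                Γ ⊢[ std ] swap⁻¹ t ≐ swap⁻¹ t′ ∶ Swap₁ X Y Z

  refl-cong : Γ ⊢[ std ] A type i →
              Γ ⊢[ std ] a ≐ a′ ∶ A →
              -----------------------------------------
              Γ ⊢[ dsp ] refl a ≐ refl a′ ∶ Homᵗʷ A a a

  j-cong : Γ ▹ A ⊢[ std ] X type i →
           MotiveCtx Γ A X ⊢[ std ] D type i′ →
           Γ ▹ A ▹ X ⊢[ dsp ] d ≐ d′ ∶ motiveAt (wk ⊙ wk) D x₁ x₁ (refl x₁) x₀ →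
           Γ ⊢[ std ] b ∶ A →
           Γ ⊢[ std ] a ∶ A →
           Γ ⊢[ dsp ] f ≐ f′ ∶ Homᵗʷ A a b →
           Γ ⊢[ std ] x ≐ x′ ∶ X / sub a →
           ---------------------------------------------------------------------
           Γ ⊢[ dsp ] j f x d ≐ j f′ x′ d′ ∶ motiveAt id D b a f x

  funext-cong : Γ ᵒᵖ ⊢[ std ] A type i →
                Γ ▹⁻ A ⊢[ std ] C type i →
                Γ ⊢[ std ] F ∶ Π A C →
                Γ ⊢[ std ] G ∶ Π A C →
                Γ ▹⁻ A ⊢[ dsp ] h ≐ h′ ∶ Homᵗʷ C (app (F ⁺) x₀) (app (G ⁺) x₀) →
                ----------------------------------------------------------------
                Γ ⊢[ dsp ] funext h ≐ funext h′ ∶ Homᵗʷ (Π A C) F G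

  Π-β : Γ ᵒᵖ ⊢[ std ] A type i →
        Γ ▹⁻ A ⊢[ std ] t ∶ C →
        Γ ᵒᵖ ⊢[ std ] u ∶ A ᵒ →
        --------------------------------------------------
        Γ ⊢[ std ] app (lam t) u ≐ t / sub u ∶ C / sub u

  Π-η : Γ ⊢[ std ] f ∶ Π A C →
        ------------------------------------------
        Γ ⊢[ std ] lam (app (f ⁺) x₀) ≐ f ∶ Π A C

  ⇒ᵗʷ-β : Γ ⊢[ std ] A type i →
          Γ ⊢[ std ] B type i →
          Γ ▹ A ⊢[ std ] t ∶ B ⁺ →
          Γ ⊢[ std ] u ∶ A →
          ----------------------------------------
          Γ ⊢[ std ] app (lam t) u ≐ t / sub u ∶ B

  ⇒ᵗʷ-η : Γ ⊢[ dsp ] f ∶ A ⇒ᵗʷ B →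
          --------------------------------------------
          Γ ⊢[ dsp ] lam (app (f ⁺) x₀) ≐ f ∶ A ⇒ᵗʷ B

  Σ-β₁ : Γ ▹ A ⊢[ std ] C type i →
         Γ ⊢[ std ] u ∶ A →
         Γ ⊢[ std ] v ∶ C / sub u →
         ----------------------------------
         Γ ⊢[ std ] fst (pair u v) ≐ u ∶ A

  Σ-β₂ : Γ ▹ A ⊢[ std ] C type i →
         Γ ⊢[ std ] u ∶ A →
         Γ ⊢[ std ] v ∶ C / sub u →
         -------------------------------------------
         Γ ⊢[ std ] snd (pair u v) ≐ v ∶ C / sub u

  Σ-η : Γ ⊢[ std ] t ∶ Σ A C →
        ---------------------------------------------
        Γ ⊢[ std ] pair (fst t) (snd t) ≐ t ∶ Σ A C

  Σᵒ-β₁ : Γ ▹ A ⊢[ std ] C type i →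
          Γ ⊢[ std ] u ∶ A ᵒ →
          Γ ⊢[ dsp ] v ∶ tw (C ᵒ) u →
          ------------------------------------
          Γ ⊢[ std ] fst (pair u v) ≐ u ∶ A ᵒ

  Σᵒ-β₂ : Γ ▹ A ⊢[ std ] C type i →
          Γ ⊢[ std ] u ∶ A ᵒ →
          Γ ⊢[ dsp ] v ∶ tw (C ᵒ) u →
          --------------------------------------------
          Γ ⊢[ dsp ] snd (pair u v) ≐ v ∶ tw (C ᵒ) u

  Σᵒ-η : Γ ⊢[ std ] t ∶ (Σ A C) ᵒ →
         -------------------------------------------------
         Γ ⊢[ std ] pair (fst t) (snd t) ≐ t ∶ (Σ A C) ᵒ

  swap⁻¹-swap : Γ ⊢[ std ] X type i →
                Γ ⊢[ std ] Y type i →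
                Γ ▹ X ▹ (Y ᵒ) ⁺ ⊢[ std ] Z type i →
                Γ ⊢[ std ] t ∶ Swap₁ X Y Z →
                --------------------------------------------
                Γ ⊢[ std ] swap⁻¹ (swap t) ≐ t ∶ Swap₁ X Y Z

  swap-swap⁻¹ : Γ ⊢[ std ] X type i →
                Γ ⊢[ std ] Y type i →
                Γ ▹ X ▹ (Y ᵒ) ⁺ ⊢[ std ] Z type i →
                Γ ⊢[ std ] s ∶ Swap₂ X Y Z →
                --------------------------------------------
                Γ ⊢[ std ] swap (swap⁻¹ s) ≐ s ∶ Swap₂ X Y Z

  -- swap sends (x,(y,z)) to (y,(x,z)).  The rules for opposite Σ-types give
  -- t : (Σ_{x:X} Σᵗʷ_{y:Y} Z(x,ȳ))ᵒᵖ the components fst t : Xᵒᵖ and a displayed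
  -- term snd t, and only in some contexts (such as the opposite of a context
  -- where the components of a term of a closed type are formed) a component
  -- fst (snd t) : Yᵒᵖ; hence the additional premise of swap-y.
  swap-x : Γ ⊢[ std ] X type i →
           Γ ⊢[ std ] Y type i →
           Γ ▹ X ▹ (Y ᵒ) ⁺ ⊢[ std ] Z type i →
           Γ ⊢[ std ] t ∶ Swap₁ X Y Z →
           ----------------------------------------------
           Γ ⊢[ std ] fst (snd (swap t)) ≐ fst t ∶ X ᵒ

  swap-y : Γ ⊢[ std ] X type i →
           Γ ⊢[ std ] Y type i →
           Γ ▹ X ▹ (Y ᵒ) ⁺ ⊢[ std ] Z type i →
           Γ ⊢[ std ] t ∶ Swap₁ X Y Z →
           Γ ⊢[ std ] fst (snd t) ∶ Y ᵒ →
           ----------------------------------------------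
           Γ ⊢[ std ] fst (swap t) ≐ fst (snd t) ∶ Y ᵒ

  j-β : Γ ▹ A ⊢[ std ] X type i →
        MotiveCtx Γ A X ⊢[ std ] D type i′ →
        Γ ▹ A ▹ X ⊢[ dsp ] d ∶ motiveAt (wk ⊙ wk) D x₁ x₁ (refl x₁) x₀ →
        Γ ⊢[ std ] a ∶ A →
        Γ ⊢[ std ] x ∶ X / sub a →
        -------------------------------------------------------------------------------
        Γ ⊢[ dsp ] j (refl a) x d ≐ d / (x ∷ a ∷ id) ∶ motiveAt id D a a (refl a) x

  directed-univalence : Γ ᵒᵖ ⊢[ std ] A ∶ 𝒮et i →
                        Γ ⊢[ std ] B ∶ 𝒮et i →
                        -----------------------------------------------------
                        Γ ⊢[ std ] A ⇒ B ≐ Hom (𝒮et i) A B ∶ 𝒮et (suc i)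

------------------------------------------------------------------------
-- Copresheaves and the Yoneda functor

_⊢_∶_ : Ctx n → Tm n → Tm n → Set
Γ ⊢ t ∶ A = Γ ⊢[ std ] t ∶ A

infix 4 _⊢_∶_

-- Nat(F,G) for F and G over a : A.
Nat : Tm n → Tm (suc n) → Tm (suc n) → Tm n
Nat A F G = Π (Σ A F) (G / (fst x₀ ∷ wk))

-- φ_a(x).
_at_,_ : Tm n → Tm n → Tm n → Tm n
φ at a , x = app φ (pair a x)

-- Y(F,a) = Nat(Hom_A(a,-),F) and Ȳ(F,a) = F a, for F : A → Set and a : A.
Yoneda Eval : Tm 0 → Tm n → Tm n → Tm n
Yoneda A F a = Nat (closed A) (Hom (closed A) (a ⁺) x₀) (app (F ⁺) x₀)
Eval   A F a = app F a

-- The domain (A → Set) × A of Y and Ȳ.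
Dom : Tm 0 → ℕ → Tm 0
Dom A i = (A ⇒ 𝒮et i) ×ᵗ A

{-# OPTIONS --safe #-}
module Submission where

-- Φ evaluates φ : Y(F,a) at (a, refl_a), and Ψ transports y : F a along arrows.
-- The obstacle is variance: refl and j concern arrows f : Hom_A(ā,b) in a
-- context Γ, whereas φ : Y(F,a) in Γ is applied to terms of
-- (Σ_{x:A} Hom_A(a,x))ᵒᵖ in Γᵒᵖ.  The type Σ_{b:A} Σᵗʷ_{a:A} Hom_A(ā,b) of all
-- arrows of A mediates between the two.  It is closed, so that its terms in Γ are
-- the terms of its opposite in Γᵒᵖ, and swap turns the latter into pairs of a
-- source a : Aᵒᵖ and a term of (Σ_{x:A} Hom_A(a,x))ᵒᵖ.  Then Φ(Ψ(y)) ≐ y by the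
-- computation rule of j, and φ(q) is connected to Ψ(Φ(φ))(q) by j over all arrows
-- out of a, hence φ to Ψ(Φ(φ)) by function extensionality.

-- The theorem asks for ordinary terms, whereas `refl`, `j` and `funext` produce displayed terms of
-- twisted types. Discreteness closes this gap: over a discrete type a twist is a plain
-- substitution, and an ordinary type has the same ordinary and displayed terms. The twists to be
-- removed are over a fibre `F a` or over `Y(F,a)`, and the latter is discrete as a Π-type of
-- discrete types. The parameter `x` in the rule for `j` does real work: the type of `φ` mentions
-- the source of the arrow, so `φ` has to vary together with the arrow that is eliminated. The
-- passages through `swap` are inverse only up to judgemental equality. Sources and targets
-- therefore match only after conversion, which is why lemmas on arrows carry equations such as
-- `dom r ≐ a`.

open import Defs
open import Data.Fin.Base using (Fin; zero; suc)
open import Data.Fin.Substitution using (Sub; Subs; Lift; TermSubst)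
open import Data.Fin.Substitution.Lemmas using (TermLemmas)
open import Data.Nat.Base using (ℕ; suc; _+_; _<_; _⊔_)
open import Data.Nat.Properties using (<⇒≤; m≤m⊔n; m≤n⊔m)
open import Data.Product.Base using (∃-syntax; _×_; _,_)
open import Data.Vec.Base using ([]; _∷_)
open import Relation.Binary.Construct.Closure.ReflexiveTransitive using (ε; _◅_)
open import Relation.Binary.PropositionalEquality
  using (_≡_; refl; sym; trans; cong; cong₂; subst)

open TermSubst termSubst using (_↑)

private
  variable
    k m n : ℕ

-- Substitution lemmas

module Lifted (T : ℕ → Set) (l : Lift T Tm) where
  open TermSubst.Lifted termSubst l
    renaming (_/_ to _/ₗ_; _↑ to _↑ₗ; _↑✶_ to _↑✶ₗ_; _/✶_ to _/✶ₗ_) public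

  ternary-/✶-↑✶ : (c : ∀ {n} → Tm n → Tm n → Tm n → Tm n) →
                  (∀ {m n} t u v (ρ : Sub T m n) → c t u v /ₗ ρ ≡ c (t /ₗ ρ) (u /ₗ ρ) (v /ₗ ρ)) →
                  ∀ k t u v (ρs : Subs T m n) →
                  c t u v /✶ₗ ρs ↑✶ₗ k ≡ c (t /✶ₗ ρs ↑✶ₗ k) (u /✶ₗ ρs ↑✶ₗ k) (v /✶ₗ ρs ↑✶ₗ k)
  ternary-/✶-↑✶ c c-/ k t u v ε        = refl
  ternary-/✶-↑✶ c c-/ k t u v (ρ ◅ ρs) =
    trans (cong (_/ₗ _) (ternary-/✶-↑✶ c c-/ k t u v ρs)) (c-/ _ _ _ _)

  binder-/✶-↑✶ : (c : ∀ {n} → Tm n → Tm (suc n) → Tm n) →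
                 (∀ {m n} t u (ρ : Sub T m n) → c t u /ₗ ρ ≡ c (t /ₗ ρ) (u /ₗ ρ ↑ₗ)) →
                 ∀ k t u (ρs : Subs T m n) →
                 c t u /✶ₗ ρs ↑✶ₗ k ≡ c (t /✶ₗ ρs ↑✶ₗ k) (u /✶ₗ ρs ↑✶ₗ suc k)
  binder-/✶-↑✶ c c-/ k t u ε        = refl
  binder-/✶-↑✶ c c-/ k t u (ρ ◅ ρs) =
    trans (cong (_/ₗ _) (binder-/✶-↑✶ c c-/ k t u ρs)) (c-/ _ _ _)

  nullary-/✶-↑✶ : (c : ∀ {n} → Tm n) → (∀ {m n} (ρ : Sub T m n) → c /ₗ ρ ≡ c) →
                  ∀ k (ρs : Subs T m n) → c /✶ₗ ρs ↑✶ₗ k ≡ c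
  nullary-/✶-↑✶ c c-/ k ε        = refl
  nullary-/✶-↑✶ c c-/ k (ρ ◅ ρs) =
    trans (cong (_/ₗ _) (nullary-/✶-↑✶ c c-/ k ρs)) (c-/ _)

  j-/✶-↑✶ : ∀ k f x d (ρs : Subs T m n) →
            j f x d /✶ₗ ρs ↑✶ₗ k ≡
            j (f /✶ₗ ρs ↑✶ₗ k) (x /✶ₗ ρs ↑✶ₗ k) (d /✶ₗ ρs ↑✶ₗ suc (suc k))
  j-/✶-↑✶ k f x d ε        = refl
  j-/✶-↑✶ k f x d (ρ ◅ ρs) = cong (_/ₗ _) (j-/✶-↑✶ k f x d ρs)

cong₃ : ∀ {A B C D : Set} (f : A → B → C → D) {a a′ b b′ c c′} →
        a ≡ a′ → b ≡ b′ → c ≡ c′ → f a b c ≡ f a′ b′ c′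
cong₃ f refl refl refl = refl

module Commute {T₁ T₂ : ℕ → Set} (l₁ : Lift T₁ Tm) (l₂ : Lift T₂ Tm)
               {m n : ℕ} (ρs₁ : Subs T₁ m n) (ρs₂ : Subs T₂ m n) where
  private
    module L₁ = Lifted T₁ l₁
    module L₂ = Lifted T₂ l₂

  _≋_ : ∀ {k} → Tm (k + m) → Tm (k + m) → Set
  _≋_ {k} t u = t L₁./✶ₗ ρs₁ L₁.↑✶ₗ k ≡ u L₂./✶ₗ ρs₂ L₂.↑✶ₗ k

  -- The only field of `TermLemmas` that needs an induction over the syntax. The helpers treat the
  -- constructors by their binding shape, each pushing a whole sequence of substitutions through at
  -- once.
  /✶-↑✶ : (∀ k x → var {k + m} x ≋ var x) → ∀ k t → _≋_ {k} t t
  /✶-↑✶ hyp = go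
    where
    ternary : (c : ∀ {n} → Tm n → Tm n → Tm n → Tm n) →
              (∀ {m n} t u v (ρ : Sub T₁ m n) →
                c t u v L₁./ₗ ρ ≡ c (t L₁./ₗ ρ) (u L₁./ₗ ρ) (v L₁./ₗ ρ)) →
              (∀ {m n} t u v (ρ : Sub T₂ m n) →
                c t u v L₂./ₗ ρ ≡ c (t L₂./ₗ ρ) (u L₂./ₗ ρ) (v L₂./ₗ ρ)) →
              ∀ {k t u v} → _≋_ {k} t t → _≋_ {k} u u → _≋_ {k} v v → _≋_ {k} (c t u v) (c t u v)
    ternary c c₁ c₂ {k} {t} {u} {v} p q r =
      trans (L₁.ternary-/✶-↑✶ c c₁ k t u v ρs₁)
            (trans (cong₃ c p q r) (sym (L₂.ternary-/✶-↑✶ c c₂ k t u v ρs₂)))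

    binder : (c : ∀ {n} → Tm n → Tm (suc n) → Tm n) →
             (∀ {m n} t u (ρ : Sub T₁ m n) → c t u L₁./ₗ ρ ≡ c (t L₁./ₗ ρ) (u L₁./ₗ ρ L₁.↑ₗ)) →
             (∀ {m n} t u (ρ : Sub T₂ m n) → c t u L₂./ₗ ρ ≡ c (t L₂./ₗ ρ) (u L₂./ₗ ρ L₂.↑ₗ)) →
             ∀ {k t u} → _≋_ {k} t t → _≋_ {suc k} u u → _≋_ {k} (c t u) (c t u)
    binder c c₁ c₂ {k} {t} {u} p q =
      trans (L₁.binder-/✶-↑✶ c c₁ k t u ρs₁)
            (trans (cong₂ c p q) (sym (L₂.binder-/✶-↑✶ c c₂ k t u ρs₂)))

    nullary : (c : ∀ {n} → Tm n) →
              (∀ {m n} (ρ : Sub T₁ m n) → c L₁./ₗ ρ ≡ c) →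
              (∀ {m n} (ρ : Sub T₂ m n) → c L₂./ₗ ρ ≡ c) →
              ∀ {k} → _≋_ {k} c c
    nullary c c₁ c₂ {k} =
      trans (L₁.nullary-/✶-↑✶ c c₁ k ρs₁) (sym (L₂.nullary-/✶-↑✶ c c₂ k ρs₂))

    unary : (c : ∀ {n} → Tm n → Tm n) →
            (∀ {m n} t (ρ : Sub T₁ m n) → c t L₁./ₗ ρ ≡ c (t L₁./ₗ ρ)) →
            (∀ {m n} t (ρ : Sub T₂ m n) → c t L₂./ₗ ρ ≡ c (t L₂./ₗ ρ)) →
            ∀ {k t} → _≋_ {k} t t → _≋_ {k} (c t) (c t)
    unary c c₁ c₂ {k} {t} p =
      ternary (λ t _ _ → c t) (λ t _ _ → c₁ t) (λ t _ _ → c₂ t) {k} {t} {t} {t} p p p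

    binary : (c : ∀ {n} → Tm n → Tm n → Tm n) →
             (∀ {m n} t u (ρ : Sub T₁ m n) → c t u L₁./ₗ ρ ≡ c (t L₁./ₗ ρ) (u L₁./ₗ ρ)) →
             (∀ {m n} t u (ρ : Sub T₂ m n) → c t u L₂./ₗ ρ ≡ c (t L₂./ₗ ρ) (u L₂./ₗ ρ)) →
             ∀ {k t u} → _≋_ {k} t t → _≋_ {k} u u → _≋_ {k} (c t u) (c t u)
    binary c c₁ c₂ {k} {t} {u} p q =
      ternary (λ t u _ → c t u) (λ t u _ → c₁ t u) (λ t u _ → c₂ t u) {k} {t} {u} {u} p q q

    go : ∀ k t → _≋_ {k} t t
    go k (var x) = hyp k x
    go k (𝒰 i) = nullary (𝒰 i) (λ _ → refl) (λ _ → refl) {k}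
    go k (𝒮et i) = nullary (𝒮et i) (λ _ → refl) (λ _ → refl) {k}
    go k (t ᵒ) = unary _ᵒ (λ _ _ → refl) (λ _ _ → refl) {k} {t} (go k t)
    go k (fst t) = unary fst (λ _ _ → refl) (λ _ _ → refl) {k} {t} (go k t)
    go k (snd t) = unary snd (λ _ _ → refl) (λ _ _ → refl) {k} {t} (go k t)
    go k (swap t) = unary swap (λ _ _ → refl) (λ _ _ → refl) {k} {t} (go k t)
    go k (swap⁻¹ t) = unary swap⁻¹ (λ _ _ → refl) (λ _ _ → refl) {k} {t} (go k t)
    go k (refl t) = unary refl (λ _ _ → refl) (λ _ _ → refl) {k} {t} (go k t)
    go k (app t u) = binary app (λ _ _ _ → refl) (λ _ _ _ → refl) {k} {t} {u} (go k t) (go k u)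
    go k (pair t u) =
      binary pair (λ _ _ _ → refl) (λ _ _ _ → refl)
        {k} {t} {u} (go k t) (go k u)
    go k (Hom A a b) =
      ternary Hom (λ _ _ _ _ → refl) (λ _ _ _ _ → refl)
        {k} {A} {a} {b} (go k A) (go k a) (go k b)
    go k (Π A C) =
      binder Π (λ _ _ _ → refl) (λ _ _ _ → refl)
        {k} {A} {C} (go k A) (go (suc k) C)
    go k (Σ A C) =
      binder Σ (λ _ _ _ → refl) (λ _ _ _ → refl)
        {k} {A} {C} (go k A) (go (suc k) C)
    go k (tw C u) =
      binder (λ u C → tw C u) (λ _ _ _ → refl) (λ _ _ _ → refl)
        {k} {u} {C} (go k u) (go (suc k) C)
    -- 𝒰 0 fills the unused argument of the binder.
    go k (lam t) =
      binder (λ _ → lam) (λ _ _ _ → refl) (λ _ _ _ → refl)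
        {k} {𝒰 0} {t} (go k (𝒰 0)) (go (suc k) t)
    go k (funext t) =
      binder (λ _ → funext) (λ _ _ _ → refl) (λ _ _ _ → refl)
        {k} {𝒰 0} {t} (go k (𝒰 0)) (go (suc k) t)
    go k (j f x d) = trans (L₁.j-/✶-↑✶ k f x d ρs₁)
      (trans (cong₃ j (go k f) (go k x) (go (suc (suc k)) d)) (sym (L₂.j-/✶-↑✶ k f x d ρs₂)))

termLemmas : TermLemmas Tm
termLemmas = record
  { termSubst = termSubst
  ; app-var   = refl
  ; /✶-↑✶     = λ {T₁ T₂ l₁ l₂} ρs₁ ρs₂ → Commute./✶-↑✶ l₁ l₂ ρs₁ ρs₂
  }

private
  module L = TermLemmas termLemmas

/-wk : (t : Tm n) → t / wk ≡ t ⁺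
/-wk t = L./-wk {t = t}

/-id : (t : Tm n) → t / id ≡ t
/-id = L.id-vanishes

/-⊙ : (t : Tm k) {σ : Sub Tm k m} {τ : Sub Tm m n} → t / (σ ⊙ τ) ≡ t / σ / τ
/-⊙ t = L./-⊙ t

⁺-∷ : (t : Tm m) {u : Tm n} {σ : Sub Tm m n} → (t ⁺) / (u ∷ σ) ≡ t / σ
⁺-∷ = L.weaken-∷

⁺-sub : (t : Tm n) {u : Tm n} → (t ⁺) / sub u ≡ t
⁺-sub = L.weaken-sub

⁺-↑ : (t : Tm m) {σ : Sub Tm m n} → (t ⁺) / (σ ↑) ≡ (t / σ) ⁺
⁺-↑ t = L.weaken-↑ t

-- `[] ⊙ σ` computes to `[]`, so a closed term absorbs every substitution.
closed-/ : (A : Tm 0) (σ : Sub Tm m n) → closed A / σ ≡ closed A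
closed-/ A σ = sym (/-⊙ A)

closed-⁺ : (A : Tm 0) → closed {n} A ⁺ ≡ closed A
closed-⁺ A = trans (sym (/-wk (closed A))) (closed-/ A wk)

private
  variable
    i i′ : ℕ
    μ ν  : Mode
    Γ Δ  : Ctx n
    A A′ B C F F′ a a′ b b′ f f′ q q′ r r′ s s′ t t′ u v v′ x x′ y φ φ′ : Tm n
    σ    : Sub Tm m n

-- Derived rules

cast : A ≡ B → Γ ⊢[ μ ] t ∶ A → Γ ⊢[ μ ] t ∶ B
cast {Γ = Γ} {μ = μ} {t = t} = subst (λ B → Γ ⊢[ μ ] t ∶ B)

cast-≐ : A ≡ B → Γ ⊢[ μ ] t ≐ t′ ∶ A → Γ ⊢[ μ ] t ≐ t′ ∶ B
cast-≐ {Γ = Γ} {μ = μ} {t = t} {t′} = subst (λ B → Γ ⊢[ μ ] t ≐ t′ ∶ B)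

⁺-type : Γ ⊢[ μ ] A type i → Γ ⊢[ ν ] B type i′ → Γ ▹[ ν ] B ⊢[ μ ] A ⁺ type i
⁺-type {Γ = Γ} {μ = μ} {A = A} {ν = ν} {B = B} ⊢A ⊢B =
  subst (λ A → Γ ▹[ ν ] B ⊢[ μ ] A type _) (/-wk A) (ty-sub ⊢A (⇛-wk ⊢B))

wk-term : Δ ⊢ wk ⇛ Γ → Γ ⊢[ μ ] t ∶ A → Δ ⊢[ μ ] t ⁺ ∶ A ⁺
wk-term {Δ = Δ} {μ = μ} {t = t} {A = A} ⊢wk ⊢t =
  subst (λ t → Δ ⊢[ μ ] t ∶ A ⁺) (/-wk t) (cast (/-wk A) (tm-sub ⊢t ⊢wk))

wk-term-≐ : Δ ⊢ wk ⇛ Γ → Γ ⊢[ μ ] A type i → Γ ⊢[ μ ] t ≐ t′ ∶ A → Δ ⊢[ μ ] t ⁺ ≐ t′ ⁺ ∶ A ⁺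
wk-term-≐ {Δ = Δ} {μ = μ} {A = A} {t = t} {t′ = t′} ⊢wk ⊢A ⊢t =
  subst (λ t → Δ ⊢[ μ ] t ≐ t′ ⁺ ∶ A ⁺) (/-wk t)
    (subst (λ t′ → Δ ⊢[ μ ] t / wk ≐ t′ ∶ A ⁺) (/-wk t′)
      (cast-≐ (/-wk A) (tm-sub ⊢A ⊢t (sub-refl ⊢wk))))

⁺-term : Γ ⊢[ μ ] t ∶ A → Γ ⊢[ ν ] B type i → Γ ▹[ ν ] B ⊢[ μ ] t ⁺ ∶ A ⁺
⁺-term t B = wk-term (⇛-wk B) t

ᵒᵖ-ᵒᵖ-⊢ : ⊢ Γ → Γ ⊢[ μ ] t ∶ A → Γ ᵒᵖ ᵒᵖ ⊢[ μ ] t ∶ A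
ᵒᵖ-ᵒᵖ-⊢ ⊢Γ = tm-ctx (ctx-sym (ᵒᵖ-ᵒᵖ ⊢Γ))

▹⁻-ctx : Γ ᵒᵖ ⊢[ std ] A type i → ⊢ Γ ▹⁻ A
▹⁻-ctx A = ᵒᵖ-ctx (▹-ctx (ty-ᵒ A))

⇛-wk⁻ : ⊢ Γ → Γ ᵒᵖ ⊢[ std ] A type i → Γ ▹⁻ A ⊢ wk ⇛ Γ
⇛-wk⁻ ⊢Γ A = ⇛-conv (ctx-refl (▹⁻-ctx A)) (ᵒᵖ-ᵒᵖ ⊢Γ) (⇛-ᵒᵖ (⇛-wk (ty-ᵒ A)))

tm-var⁻ : Γ ᵒᵖ ⊢[ std ] A type i → (Γ ▹⁻ A) ᵒᵖ ⊢[ std ] x₀ ∶ (A ⁺) ᵒ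
tm-var⁻ A = ᵒᵖ-ᵒᵖ-⊢ (▹-ctx (ty-ᵒ A)) (tm-var (ty-ᵒ A))

⇛-sub : ⊢ Γ → Γ ⊢[ μ ] A type i → Γ ⊢[ μ ] t ∶ A → Γ ⊢ sub t ⇛ Γ ▹[ μ ] A
⇛-sub ⊢Γ A t = ⇛-∷ (⇛-id ⊢Γ) A (cast (sym (/-id _)) t)

⇛-sub-≐ : ⊢ Γ → Γ ⊢[ μ ] A type i → Γ ⊢[ μ ] t ≐ t′ ∶ A →
          Γ ⊢ sub t ≐ sub t′ ⇛ Γ ▹[ μ ] A
⇛-sub-≐ ⊢Γ A t = ∷-cong (sub-refl (⇛-id ⊢Γ)) A (cast-≐ (sym (/-id _)) t)

module _ (⊢Γ : ⊢ Γ) (⊢A : Γ ⊢[ std ] A type i) where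

  -- The two kinds of term meet in the context equality `▹ᵈ-std`: a displayed term may be
  -- substituted for the variable of `Γ ▹ᵈ A`, which is the ordinary variable of `Γ ▹ A`.
  dsp⇒std : Γ ⊢[ dsp ] t ∶ A → Γ ⊢[ std ] t ∶ A
  dsp⇒std t = cast (⁺-sub A)
    (tm-sub (tm-var ⊢A) (⇛-conv (ctx-refl ⊢Γ) (▹ᵈ-std ⊢A) (⇛-sub ⊢Γ (ty-dsp ⊢A) t)))

  std⇒dsp : Γ ⊢[ std ] t ∶ A → Γ ⊢[ dsp ] t ∶ A
  std⇒dsp t = cast (⁺-sub A)
    (tm-sub (tm-var (ty-dsp ⊢A)) (⇛-conv (ctx-refl ⊢Γ) (ctx-sym (▹ᵈ-std ⊢A)) (⇛-sub ⊢Γ ⊢A t)))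

  dsp⇒std-≐ : Γ ⊢[ dsp ] t ≐ t′ ∶ A → Γ ⊢[ std ] t ≐ t′ ∶ A
  dsp⇒std-≐ t = cast-≐ (⁺-sub A)
    (tm-sub (⁺-type ⊢A ⊢A) (tm-≐-refl (tm-var ⊢A))
      (sub-conv (ctx-refl ⊢Γ) (▹ᵈ-std ⊢A) (⇛-sub-≐ ⊢Γ (ty-dsp ⊢A) t)))

-- Closed types and opposite contexts
module _ {T : Tm 0} (⊢T : ◇ ⊢[ std ] T type i) where

  closed-type : ⊢ Γ → Γ ⊢[ std ] closed T type i
  closed-type ⊢Γ = ty-sub ⊢T (⇛-[] ⊢Γ)

  ⇛-closed : ⊢ Γ → Γ ⊢[ std ] t ∶ closed T → Γ ⊢ t ∷ [] ⇛ ◇ ▹ T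
  ⇛-closed ⊢Γ t = ⇛-∷ (⇛-[] ⊢Γ) ⊢T t

  ⇛-closed-≐ : ⊢ Γ → Γ ⊢[ std ] t ≐ t′ ∶ closed T → Γ ⊢ t ∷ [] ≐ t′ ∷ [] ⇛ ◇ ▹ T
  ⇛-closed-≐ ⊢Γ t = ∷-cong (sub-refl (⇛-[] ⊢Γ)) ⊢T t

  private
    ⊢T⁻ : ◇ ᵒᵖ ⊢[ std ] T ᵒ type i
    ⊢T⁻ = ty-ᵒ (ty-ctx (ctx-sym ◇-ᵒᵖ) ⊢T)

    ▹-closed-ᵒᵖ : ⊢ (◇ ▹ T) ᵒᵖ ≐ ◇ ᵒᵖ ▹ T ᵒ
    ▹-closed-ᵒᵖ = ctx-trans
      (ᵒᵖ-cong (subst (λ T → ⊢ ◇ ▹ T ≐ ◇ ▹⁻ T) (/-id T) (▹⁻-closed ◇-ctx ⊢T)))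
      (ᵒᵖ-ᵒᵖ (▹-ctx ⊢T⁻))

    closed-∷ : (t : Tm n) → (T ᵒ) ⁺ / (t ∷ []) ≡ closed T ᵒ
    closed-∷ t = ⁺-∷ (T ᵒ)

  -- A term of a closed type is a substitution into `◇ ▹ T`. Its opposite lands in `(◇ ▹ T) ᵒᵖ`,
  -- which is `◇ ᵒᵖ ▹ T ᵒ` by `▹⁻-closed`, and the variable there pulls back to the same raw term.
  closed-ᵒᵖ : ⊢ Γ → Γ ⊢[ std ] t ∶ closed T → Γ ᵒᵖ ⊢[ std ] t ∶ closed T ᵒ
  closed-ᵒᵖ {t = t} ⊢Γ ⊢t = cast (closed-∷ t)
    (tm-sub (tm-var ⊢T⁻)
      (⇛-conv (ctx-refl (ᵒᵖ-ctx ⊢Γ)) ▹-closed-ᵒᵖ (⇛-ᵒᵖ (⇛-closed ⊢Γ ⊢t))))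

  closed-ᵒᵖ-≐ : ⊢ Γ → Γ ⊢[ std ] t ≐ t′ ∶ closed T → Γ ᵒᵖ ⊢[ std ] t ≐ t′ ∶ closed T ᵒ
  closed-ᵒᵖ-≐ {t = t} ⊢Γ ⊢t = cast-≐ (closed-∷ t)
    (tm-sub (⁺-type ⊢T⁻ ⊢T⁻) (tm-≐-refl (tm-var ⊢T⁻))
      (sub-conv (ctx-refl (ᵒᵖ-ctx ⊢Γ)) ▹-closed-ᵒᵖ (sub-ᵒᵖ (⇛-closed-≐ ⊢Γ ⊢t))))

module _ {T : Tm 0} (⊢T : ◇ ⊢[ std ] T type i) where

  -- The passage to opposites is an involution: `closed-ᵒᵖ` is used at `T ᵒ` and `Γ ᵒᵖ`, and the
  -- double opposites cancel.
  closed-ᵒᵖ⁻¹ : ⊢ Γ → Γ ᵒᵖ ⊢[ std ] t ∶ closed T ᵒ → Γ ⊢[ std ] t ∶ closed T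
  closed-ᵒᵖ⁻¹ ⊢Γ ⊢t = tm-conv (ᵒ-ᵒ (closed-type ⊢T ⊢Γ))
    (tm-ctx (ᵒᵖ-ᵒᵖ ⊢Γ) (closed-ᵒᵖ (ty-ᵒ ⊢T) (ᵒᵖ-ctx ⊢Γ) ⊢t))

  closed-ᵒᵖ⁻¹-≐ : ⊢ Γ → Γ ᵒᵖ ⊢[ std ] t ≐ t′ ∶ closed T ᵒ → Γ ⊢[ std ] t ≐ t′ ∶ closed T
  closed-ᵒᵖ⁻¹-≐ ⊢Γ ⊢t = tm-conv (ᵒ-ᵒ (closed-type ⊢T ⊢Γ))
    (tm-ctx (ᵒᵖ-ᵒᵖ ⊢Γ) (closed-ᵒᵖ-≐ (ty-ᵒ ⊢T) (ᵒᵖ-ctx ⊢Γ) ⊢t))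

-- Discrete types
𝒮et-type : Γ ⊢[ std ] A ∶ 𝒮et i → Γ ⊢[ std ] A type i
𝒮et-type A = ty-El (tm-𝒮et-𝒰 A)

𝒮et-≐-type : Γ ⊢[ std ] A ≐ A′ ∶ 𝒮et i → Γ ⊢[ std ] A ≐ A′ type i
𝒮et-≐-type A = ty-El (tm-𝒮et-𝒰 A)

module _ (⊢Γ : ⊢ Γ) (⊢B : Γ ⊢[ std ] B ∶ 𝒮et i) where

  ᵒ-term : Γ ⊢[ std ] t ∶ B → Γ ⊢[ std ] t ∶ B ᵒ
  ᵒ-term = tm-conv (ty-sym (ᵒ-𝒮et ⊢B))

  ᵒ-term-≐ : Γ ⊢[ std ] t ≐ t′ ∶ B → Γ ⊢[ std ] t ≐ t′ ∶ B ᵒ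
  ᵒ-term-≐ = tm-conv (ty-sym (ᵒ-𝒮et ⊢B))

  Hom-𝒮et : Γ ⊢[ std ] u ∶ B → Γ ⊢[ std ] v ∶ B → Γ ⊢[ std ] Hom B u v ∶ 𝒮et i
  Hom-𝒮et u v = tm-Hom (𝒮et-type ⊢B) (ᵒ-term u) v

  -- For discrete `B` the twist is substitution by `tw-𝒮et`. This turns the outputs of `refl` and
  -- `funext` into terms of the untwisted `Hom` of the theorem.
  Homᵗʷ-discrete : Γ ⊢[ std ] u ∶ B → Γ ⊢[ std ] v ∶ B →
                   Γ ⊢[ dsp ] Homᵗʷ B u v ≐ Hom B u v type i
  Homᵗʷ-discrete {u = u} {v = v} ⊢u ⊢v =
    subst (λ A → Γ ⊢[ dsp ] Homᵗʷ B u v ≐ A type i)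
      (cong₂ (λ B v → Hom B u v) (⁺-sub B) (⁺-sub v))
      (tw-𝒮et ⊢B
        (𝒮et-type (tm-Hom (⁺-type (𝒮et-type ⊢B) ⊢Bᵒ) (tm-var ⊢Bᵒ) (⁺-term ⊢v ⊢Bᵒ)))
        ⊢u)
    where
    ⊢Bᵒ = ty-ᵒ (𝒮et-type ⊢B)

  Homᵗʷ⇒Hom : Γ ⊢[ std ] u ∶ B → Γ ⊢[ std ] v ∶ B →
              Γ ⊢[ dsp ] t ∶ Homᵗʷ B u v → Γ ⊢[ std ] t ∶ Hom B u v
  Homᵗʷ⇒Hom u v t =
    dsp⇒std ⊢Γ (𝒮et-type (Hom-𝒮et u v)) (tm-conv (Homᵗʷ-discrete u v) t)

  Hom⇒Homᵗʷ : Γ ⊢[ std ] u ∶ B → Γ ⊢[ std ] v ∶ B →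
              Γ ⊢[ std ] t ∶ Hom B u v → Γ ⊢[ dsp ] t ∶ Homᵗʷ B u v
  Hom⇒Homᵗʷ u v t =
    tm-conv (ty-sym (Homᵗʷ-discrete u v)) (std⇒dsp ⊢Γ (𝒮et-type (Hom-𝒮et u v)) t)

  refl-discrete : Γ ⊢[ std ] u ∶ B → Γ ⊢[ std ] refl u ∶ Hom B u u
  refl-discrete u = Homᵗʷ⇒Hom u u (tm-refl (𝒮et-type ⊢B) u)

module _ {T : Tm 0} (⊢T : ◇ ⊢[ std ] T type i) {C b : Tm 1} (⊢b : ◇ ▹ T ⊢[ std ] b ∶ C) where

  private
    -- `closed (lam b)` computes to `lam (b / ([] ↑))`. Its variable has type `T ᵒ` in the opposite
    -- context, hence type `T` in `Γ ▹⁻ closed T`, where `b` can be instantiated as `Π-β` requires.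
    ⊢body : ⊢ Γ → Γ ▹⁻ closed T ⊢[ std ] b / ([] ↑) ∶ C / ([] ↑)
    ⊢body {Γ = Γ} ⊢Γ = tm-sub ⊢b (⇛-closed ⊢T ⊢Γ′
      (closed-ᵒᵖ⁻¹ ⊢T ⊢Γ′ (cast (cong _ᵒ (closed-⁺ T)) (tm-var⁻ ⊢T⁻))))
      where
      ⊢T⁻ = closed-type ⊢T (ᵒᵖ-ctx ⊢Γ)
      ⊢Γ′ = ▹⁻-ctx ⊢T⁻

  lam-closed : ◇ ⊢[ std ] lam b ∶ Π T C
  lam-closed = tm-lam (ty-ctx (ctx-sym ◇-ᵒᵖ) ⊢T)
    (tm-ctx (subst (λ T → ⊢ ◇ ▹ T ≐ ◇ ▹⁻ T) (/-id T) (▹⁻-closed ◇-ctx ⊢T)) ⊢b)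

  module _ (⊢Γ : ⊢ Γ) (⊢u : Γ ⊢[ std ] u ∶ closed T) where

    private
      ∷-≡ : (t : Tm 1) → t / ([] ↑) / sub u ≡ t / (u ∷ [])
      ∷-≡ t = sym (/-⊙ t)

    app-closed : Γ ⊢[ std ] app (closed (lam b)) u ∶ C / (u ∷ [])
    app-closed = cast (∷-≡ C) (tm-app (tm-sub lam-closed (⇛-[] ⊢Γ)) (closed-ᵒᵖ ⊢T ⊢Γ ⊢u))

    β-closed : Γ ⊢[ std ] app (closed (lam b)) u ≐ b / (u ∷ []) ∶ C / (u ∷ [])
    β-closed = subst (λ t → Γ ⊢[ std ] app (closed (lam b)) u ≐ t ∶ C / (u ∷ [])) (∷-≡ b)
      (cast-≐ (∷-≡ C)
        (Π-β (closed-type ⊢T (ᵒᵖ-ctx ⊢Γ)) (⊢body ⊢Γ) (closed-ᵒᵖ ⊢T ⊢Γ ⊢u)))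

-- Copresheaves on a closed type, coslices and the Yoneda functor

private
  x₃ : Tm (4 + n)
  x₃ = var (suc (suc (suc zero)))

-- `N` is a size for `A` and, because `𝒮et ℓ` has size `suc ℓ`, lies strictly above `ℓ`. One common
-- size is kept throughout, since the rules for Π, Σ and `swap` take their components at equal size.
module Copresheaves (A : Tm 0) {N ℓ : ℕ} (ℓ<N : ℓ < N) (⊢A : ◇ ⊢[ std ] A type N) where

  𝔸 : Tm n
  𝔸 = closed A

  𝔸-type : ⊢ Γ → Γ ⊢[ std ] 𝔸 type N
  𝔸-type = closed-type ⊢A

  𝔸-cast⁺ : Γ ⊢[ μ ] t ∶ 𝔸 ⁺ → Γ ⊢[ μ ] t ∶ 𝔸
  𝔸-cast⁺ = cast (closed-⁺ A)

  𝔸ᵒ-cast⁺ : Γ ⊢[ μ ] t ∶ (𝔸 ⁺) ᵒ → Γ ⊢[ μ ] t ∶ 𝔸 ᵒ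
  𝔸ᵒ-cast⁺ = cast (cong _ᵒ (closed-⁺ A))

  𝔽 : Tm n
  𝔽 = Π 𝔸 (𝒮et ℓ)

  𝔽-closed : closed (𝔽 {0}) ≡ 𝔽 {n}
  𝔽-closed = cong (λ B → Π B (𝒮et ℓ)) (closed-/ A [])

  𝔽-⁺ : 𝔽 {n} ⁺ ≡ 𝔽
  𝔽-⁺ = cong (λ B → Π B (𝒮et ℓ)) (closed-⁺ A)

  module _ (⊢Γ : ⊢ Γ) where

    𝔽-type : Γ ⊢[ std ] 𝔽 type N
    𝔽-type = ty-Π (𝔸-type (ᵒᵖ-ctx ⊢Γ)) (ty-lift ℓ<N (ty-𝒮et (▹⁻-ctx (𝔸-type (ᵒᵖ-ctx ⊢Γ)))))

    -- `tm-app` wants its argument in `Γ ᵒᵖ`; as `𝔸` is closed, a term `a` of `Γ` serves.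
    app-F : Γ ⊢[ std ] F ∶ 𝔽 → Γ ⊢[ std ] a ∶ 𝔸 → Γ ⊢[ std ] app F a ∶ 𝒮et N
    app-F F a = tm-𝒮et-lift (<⇒≤ ℓ<N) (tm-app F (closed-ᵒᵖ ⊢A ⊢Γ a))

    app-F-cong : Γ ⊢[ std ] F ∶ 𝔽 → Γ ⊢[ std ] a ≐ a′ ∶ 𝔸 →
                 Γ ⊢[ std ] app F a ≐ app F a′ ∶ 𝒮et N
    app-F-cong F a =
      tm-𝒮et-lift (<⇒≤ ℓ<N) (app-cong (tm-≐-refl F) (closed-ᵒᵖ-≐ ⊢A ⊢Γ a))

  -- For a : Aᵒᵖ, whereas Slice below is for b : A.
  Coslice : Tm n → Tm n
  Coslice a = Σ 𝔸 (Hom 𝔸 (a ⁺) x₀)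

  Coslice-/ : (a : Tm m) (σ : Sub Tm m n) → Coslice a / σ ≡ Coslice (a / σ)
  Coslice-/ a σ = cong₂ Σ (closed-/ A σ)
    (cong₂ (λ B a → Hom B a x₀) (closed-/ A (σ ↑)) (⁺-↑ a))

  Coslice-⁺ : (a : Tm n) → Coslice a ⁺ ≡ Coslice (a ⁺)
  Coslice-⁺ a = trans (sym (/-wk (Coslice a))) (trans (Coslice-/ a wk) (cong Coslice (/-wk a)))

  Hom-type : ⊢ Γ → Γ ⊢[ std ] a ∶ 𝔸 ᵒ → Γ ⊢[ std ] b ∶ 𝔸 → Γ ⊢[ std ] Hom 𝔸 a b ∶ 𝒮et N
  Hom-type ⊢Γ = tm-Hom (𝔸-type ⊢Γ)

  module _ (⊢Γ : ⊢ Γ) (⊢a : Γ ⊢[ std ] a ∶ 𝔸 ᵒ) where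

    Coslice-Hom : Γ ▹ 𝔸 ⊢[ std ] Hom 𝔸 (a ⁺) x₀ ∶ 𝒮et N
    Coslice-Hom = Hom-type (▹-ctx ⊢𝔸) (𝔸ᵒ-cast⁺ (⁺-term ⊢a ⊢𝔸)) (𝔸-cast⁺ (tm-var ⊢𝔸))
      where ⊢𝔸 = 𝔸-type ⊢Γ

    Coslice-type : Γ ⊢[ std ] Coslice a type N
    Coslice-type = ty-Σ (𝔸-type ⊢Γ) (𝒮et-type Coslice-Hom)

    Coslice-cong : Γ ⊢[ std ] a ≐ a′ ∶ 𝔸 ᵒ → Γ ⊢[ std ] Coslice a ≐ Coslice a′ type N
    Coslice-cong a≐a′ = Σ-cong ⊢𝔸 (ty-refl ⊢𝔸)
      (𝒮et-≐-type (Hom-cong (ty-refl (𝔸-type (▹-ctx ⊢𝔸)))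
        (cast-≐ (cong _ᵒ (closed-⁺ A)) (wk-term-≐ (⇛-wk ⊢𝔸) (ty-ᵒ ⊢𝔸) a≐a′))
        (tm-≐-refl (𝔸-cast⁺ (tm-var ⊢𝔸)))))
      where ⊢𝔸 = 𝔸-type ⊢Γ

  -- `Yoneda A F a` with the substitution in the codomain of `Nat` carried out. In the statement,
  -- where `F` is a variable or a projection of one, the two agree by computation.
  Y : Tm n → Tm n → Tm n
  Y F a = Π (Coslice a) (app (F ⁺) (fst x₀))

  Y-/ : (F a : Tm m) (σ : Sub Tm m n) → Y F a / σ ≡ Y (F / σ) (a / σ)
  Y-/ F a σ = cong₂ Π (Coslice-/ a σ) (cong (λ F → app F (fst x₀)) (⁺-↑ F))

  Y-⁺ : (F a : Tm n) → Y F a ⁺ ≡ Y (F ⁺) (a ⁺)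
  Y-⁺ F a = trans (sym (/-wk (Y F a)))
    (trans (Y-/ F a wk) (cong₂ Y (/-wk F) (/-wk a)))

  module _ (⊢Γ : ⊢ Γ) (⊢F : Γ ⊢[ std ] F ∶ 𝔽) (⊢a : Γ ⊢[ std ] a ∶ 𝔸) where

    Coslice⁻ : Γ ᵒᵖ ⊢[ std ] Coslice a type N
    Coslice⁻ = Coslice-type (ᵒᵖ-ctx ⊢Γ) (closed-ᵒᵖ ⊢A ⊢Γ ⊢a)

    ⊢Γ▹⁻ : ⊢ Γ ▹⁻ Coslice a
    ⊢Γ▹⁻ = ▹⁻-ctx Coslice⁻

    ⇛-wk-Coslice : Γ ▹⁻ Coslice a ⊢ wk ⇛ Γ
    ⇛-wk-Coslice = ⇛-wk⁻ ⊢Γ Coslice⁻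

    q-var : (Γ ▹⁻ Coslice a) ᵒᵖ ⊢[ std ] x₀ ∶ (Coslice (a ⁺)) ᵒ
    q-var = cast (cong _ᵒ (Coslice-⁺ a)) (tm-var⁻ Coslice⁻)

    F⁺ : Γ ▹⁻ Coslice a ⊢[ std ] F ⁺ ∶ 𝔽
    F⁺ = cast 𝔽-⁺ (wk-term ⇛-wk-Coslice ⊢F)

    a⁺ : Γ ▹⁻ Coslice a ⊢[ std ] a ⁺ ∶ 𝔸
    a⁺ = 𝔸-cast⁺ (wk-term ⇛-wk-Coslice ⊢a)

    -- The variable is a term of the opposite coslice in the opposite context, so its target is
    -- obtained there first. As `𝔸` is closed, the target returns to `Γ ▹⁻ Coslice a`, where `F` can
    -- be applied to it.
    q-cod : Γ ▹⁻ Coslice a ⊢[ std ] fst x₀ ∶ 𝔸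
    q-cod = closed-ᵒᵖ⁻¹ ⊢A ⊢Γ▹⁻ (tm-fstᵒ q-var)

    F-q : Γ ▹⁻ Coslice a ⊢[ std ] app (F ⁺) (fst x₀) ∶ 𝒮et N
    F-q = app-F ⊢Γ▹⁻ F⁺ q-cod

    Y-𝒮et : Γ ⊢[ std ] Y F a ∶ 𝒮et N
    Y-𝒮et = tm-Π-𝒮et Coslice⁻ F-q

    Y-type : Γ ⊢[ std ] Y F a type N
    Y-type = 𝒮et-type Y-𝒮et

    Y-cong : Γ ⊢[ std ] a ≐ a′ ∶ 𝔸 → Γ ⊢[ std ] Y F a ≐ Y F a′ type N
    Y-cong a≐a′ = Π-cong Coslice⁻
      (Coslice-cong (ᵒᵖ-ctx ⊢Γ) (closed-ᵒᵖ ⊢A ⊢Γ ⊢a) (closed-ᵒᵖ-≐ ⊢A ⊢Γ a≐a′))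
      (ty-refl (𝒮et-type F-q))

  app-Y-≡ : (F q : Tm n) → app (F ⁺) (fst x₀) / sub q ≡ app F (fst q)
  app-Y-≡ F q = cong (λ F → app F (fst q)) (⁺-sub F)

  app-Y : Γ ⊢[ std ] φ ∶ Y F a → Γ ᵒᵖ ⊢[ std ] q ∶ (Coslice a) ᵒ →
          Γ ⊢[ std ] app φ q ∶ app F (fst q)
  app-Y {F = F} {q = q} φ ⊢q = cast (app-Y-≡ F q) (tm-app φ ⊢q)

  app-Y-cong : Γ ⊢[ std ] φ ≐ φ′ ∶ Y F a → Γ ᵒᵖ ⊢[ std ] q ≐ q′ ∶ (Coslice a) ᵒ →
               Γ ⊢[ std ] app φ q ≐ app φ′ q′ ∶ app F (fst q)
  app-Y-cong {F = F} {q = q} φ ⊢q = cast-≐ (app-Y-≡ F q) (app-cong φ ⊢q)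

  -- Arrows

  Slice : Tm n → Tm n
  Slice b = Σᵗʷ 𝔸 (Hom 𝔸 x₀ (b ⁺))

  Arrow : Tm n
  Arrow = Σ 𝔸 (Slice x₀)

  Slice-/ : (b : Tm m) (σ : Sub Tm m n) → Slice b / σ ≡ Slice (b / σ)
  Slice-/ b σ = cong₂ (λ B C → (Σ (B ᵒ) (C ᵒ)) ᵒ) (closed-/ A σ)
    (cong₂ (λ B b → Hom B x₀ b) (closed-/ A (σ ↑)) (⁺-↑ b))

  Arrow-/ : (σ : Sub Tm m n) → Arrow / σ ≡ Arrow
  Arrow-/ σ = cong₂ Σ (closed-/ A σ) (Slice-/ x₀ (σ ↑))

  module _ (⊢Γ : ⊢ Γ) (⊢b : Γ ⊢[ std ] b ∶ 𝔸) where

    Slice-Hom : Γ ▹ 𝔸 ᵒ ⊢[ std ] Hom 𝔸 x₀ (b ⁺) ∶ 𝒮et N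
    Slice-Hom = Hom-type (▹-ctx ⊢𝔸ᵒ) (𝔸ᵒ-cast⁺ (tm-var ⊢𝔸ᵒ)) (𝔸-cast⁺ (⁺-term ⊢b ⊢𝔸ᵒ))
      where ⊢𝔸ᵒ = ty-ᵒ (𝔸-type ⊢Γ)

    Slice-Homᵒ : Γ ▹ 𝔸 ᵒ ⊢[ std ] Hom 𝔸 x₀ (b ⁺) ᵒ type N
    Slice-Homᵒ = ty-ᵒ (𝒮et-type Slice-Hom)

    Slice-type : Γ ⊢[ std ] Slice b type N
    Slice-type = ty-ᵒ (ty-Σ (ty-ᵒ (𝔸-type ⊢Γ)) Slice-Homᵒ)

    -- `Σᵗʷ` puts one opposite on the fibre and the rules for opposite Σ-types put a second one; the
    -- two cancel under `tw`.
    tw-≐-Homᵗʷ : Γ ⊢[ std ] a ≐ a′ ∶ 𝔸 →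
                 Γ ⊢[ dsp ] tw ((Hom 𝔸 x₀ (b ⁺) ᵒ) ᵒ) a ≐ Homᵗʷ 𝔸 a′ b type N
    tw-≐-Homᵗʷ {a = a} {a′ = a′} ⊢a =
      subst (λ B → Γ ⊢[ dsp ] tw ((Hom 𝔸 x₀ (b ⁺) ᵒ) ᵒ) a ≐ tw (Hom B x₀ (b ⁺)) a′ type N)
        (sym (closed-⁺ A))
        (tw-cong (𝔸-type ⊢Γ) (ᵒ-ᵒ (𝒮et-type Slice-Hom)) ⊢a)

    Homᵗʷ-cong : Γ ⊢[ std ] a ≐ a′ ∶ 𝔸 → Γ ⊢[ std ] b ≐ b′ ∶ 𝔸 →
                 Γ ⊢[ dsp ] Homᵗʷ 𝔸 a b ≐ Homᵗʷ 𝔸 a′ b′ type N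
    Homᵗʷ-cong {a = a} {a′ = a′} {b′ = b′} ⊢a ⊢b =
      subst (λ B → Γ ⊢[ dsp ] tw (Hom B x₀ (b ⁺)) a ≐ tw (Hom B x₀ (b′ ⁺)) a′ type N)
        (sym (closed-⁺ A))
        (tw-cong (𝔸-type ⊢Γ)
          (𝒮et-≐-type (Hom-cong (ty-refl (𝔸-type (▹-ctx ⊢𝔸ᵒ)))
            (tm-≐-refl (𝔸ᵒ-cast⁺ (tm-var ⊢𝔸ᵒ)))
            (cast-≐ (closed-⁺ A) (wk-term-≐ (⇛-wk ⊢𝔸ᵒ) (𝔸-type ⊢Γ) ⊢b))))
          ⊢a)
      where ⊢𝔸ᵒ = ty-ᵒ (𝔸-type ⊢Γ)

  module _ (⊢Γ : ⊢ Γ) where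

    Slice-x₀ : Γ ▹ 𝔸 ⊢[ std ] Slice x₀ type N
    Slice-x₀ = Slice-type (▹-ctx (𝔸-type ⊢Γ)) (𝔸-cast⁺ (tm-var (𝔸-type ⊢Γ)))

    Arrow-type : Γ ⊢[ std ] Arrow type N
    Arrow-type = ty-Σ (𝔸-type ⊢Γ) Slice-x₀

    ᵒᵒ-𝔸 : Γ ⊢[ std ] t ∶ 𝔸 → Γ ⊢[ std ] t ∶ 𝔸 ᵒ ᵒ
    ᵒᵒ-𝔸 = tm-conv (ty-sym (ᵒ-ᵒ (𝔸-type ⊢Γ)))

    𝔸-ᵒᵒ : Γ ⊢[ std ] t ∶ 𝔸 ᵒ ᵒ → Γ ⊢[ std ] t ∶ 𝔸
    𝔸-ᵒᵒ = tm-conv (ᵒ-ᵒ (𝔸-type ⊢Γ))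

  cod dom hom : Tm n → Tm n
  cod r = fst r
  dom r = fst (snd r)
  hom r = snd (snd r)

  arrow : (b a f : Tm n) → Tm n
  arrow b a f = pair b (pair a f)

  idArrow : Tm n → Tm n
  idArrow a = arrow a a (refl a)

  Slice-sub : (b : Tm n) → Slice x₀ / sub b ≡ Slice b
  Slice-sub b = Slice-/ x₀ (sub b)

  module _ (⊢Γ : ⊢ Γ) (⊢b : Γ ⊢[ std ] b ∶ 𝔸) (⊢a : Γ ⊢[ std ] a ∶ 𝔸)
           (⊢f : Γ ⊢[ dsp ] f ∶ Homᵗʷ 𝔸 a b) where

    private
      ⊢f′ : Γ ⊢[ dsp ] f ∶ tw ((Hom 𝔸 x₀ (b ⁺) ᵒ) ᵒ) a
      ⊢f′ = tm-conv (ty-sym (tw-≐-Homᵗʷ ⊢Γ ⊢b (tm-≐-refl ⊢a))) ⊢f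

      slice-tm : Γ ⊢[ std ] pair a f ∶ Slice b
      slice-tm = tm-pairᵒ (Slice-Homᵒ ⊢Γ ⊢b) (ᵒᵒ-𝔸 ⊢Γ ⊢a) ⊢f′

      snd-β : Γ ⊢[ std ] snd (arrow b a f) ≐ pair a f ∶ Slice b
      snd-β = cast-≐ (Slice-sub b)
        (Σ-β₂ (Slice-x₀ ⊢Γ) ⊢b (cast (sym (Slice-sub b)) slice-tm))

    arrow-tm : Γ ⊢[ std ] arrow b a f ∶ Arrow
    arrow-tm = tm-pair (Slice-x₀ ⊢Γ) ⊢b (cast (sym (Slice-sub b)) slice-tm)

    cod-β : Γ ⊢[ std ] cod (arrow b a f) ≐ b ∶ 𝔸
    cod-β = Σ-β₁ (Slice-x₀ ⊢Γ) ⊢b (cast (sym (Slice-sub b)) slice-tm)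

    dom-β : Γ ⊢[ std ] dom (arrow b a f) ≐ a ∶ 𝔸
    dom-β = tm-conv (ᵒ-ᵒ (𝔸-type ⊢Γ))
      (tm-≐-trans (fstᵒ-cong snd-β) (Σᵒ-β₁ (Slice-Homᵒ ⊢Γ ⊢b) (ᵒᵒ-𝔸 ⊢Γ ⊢a) ⊢f′))

    hom-β : Γ ⊢[ dsp ] hom (arrow b a f) ≐ f ∶ Homᵗʷ 𝔸 a b
    hom-β = tm-≐-trans
      (tm-conv (tw-≐-Homᵗʷ ⊢Γ ⊢b dom-β) (sndᵒ-cong snd-β))
      (tm-conv (tw-≐-Homᵗʷ ⊢Γ ⊢b (tm-≐-refl ⊢a)) (Σᵒ-β₂ (Slice-Homᵒ ⊢Γ ⊢b) (ᵒᵒ-𝔸 ⊢Γ ⊢a) ⊢f′))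

  idArrow-tm : ⊢ Γ → Γ ⊢[ std ] a ∶ 𝔸 → Γ ⊢[ std ] idArrow a ∶ Arrow
  idArrow-tm ⊢Γ ⊢a = arrow-tm ⊢Γ ⊢a ⊢a (tm-refl (𝔸-type ⊢Γ) ⊢a)

  -- As idArrow a is an instance of a term over ◇ ▹ A, no congruence rule for pairs
  -- in opposite Σ-types is needed.
  idArrow-cong : ⊢ Γ → Γ ⊢[ std ] a ≐ a′ ∶ 𝔸 → Γ ⊢[ std ] idArrow a ≐ idArrow a′ ∶ Arrow
  idArrow-cong {a = a} ⊢Γ ⊢a = cast-≐ (Arrow-/ (a ∷ []))
    (tm-sub (Arrow-type ⊢◇▹A)
      (tm-≐-refl (idArrow-tm ⊢◇▹A (cast (sym (/-wk A)) (tm-var ⊢A))))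
      (⇛-closed-≐ ⊢A ⊢Γ ⊢a))
    where ⊢◇▹A = ▹-ctx ⊢A

  module _ (⊢Γ : ⊢ Γ) (⊢r : Γ ⊢[ std ] r ∶ Arrow) where

    private
      ⊢snd : Γ ⊢[ std ] snd r ∶ Slice (cod r)
      ⊢snd = cast (Slice-sub (fst r)) (tm-snd ⊢r)

    cod-tm : Γ ⊢[ std ] cod r ∶ 𝔸
    cod-tm = tm-fst ⊢r

    dom-tm : Γ ⊢[ std ] dom r ∶ 𝔸
    dom-tm = 𝔸-ᵒᵒ ⊢Γ (tm-fstᵒ ⊢snd)

    hom-tm : Γ ⊢[ dsp ] hom r ∶ Homᵗʷ 𝔸 (dom r) (cod r)
    hom-tm = tm-conv (tw-≐-Homᵗʷ ⊢Γ cod-tm (tm-≐-refl dom-tm)) (tm-sndᵒ ⊢snd)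

    arrow-η : Γ ⊢[ std ] arrow (cod r) (dom r) (hom r) ≐ r ∶ Arrow
    arrow-η = tm-≐-trans
      (pair-cong (Slice-x₀ ⊢Γ) (tm-≐-refl cod-tm)
        (cast-≐ (sym (Slice-sub (fst r))) (Σᵒ-η ⊢snd)))
      (Σ-η ⊢r)

    module _ (r≐r′ : Γ ⊢[ std ] r ≐ r′ ∶ Arrow) where
      private
        snd-≐ : Γ ⊢[ std ] snd r ≐ snd r′ ∶ Slice (cod r)
        snd-≐ = cast-≐ (Slice-sub (fst r)) (snd-cong r≐r′)

      dom-cong : Γ ⊢[ std ] dom r ≐ dom r′ ∶ 𝔸
      dom-cong = tm-conv (ᵒ-ᵒ (𝔸-type ⊢Γ)) (fstᵒ-cong snd-≐)

      hom-cong : Γ ⊢[ dsp ] hom r ≐ hom r′ ∶ Homᵗʷ 𝔸 (dom r) (cod r)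
      hom-cong = tm-conv (tw-≐-Homᵗʷ ⊢Γ cod-tm (tm-≐-refl dom-tm)) (sndᵒ-cong snd-≐)

  -- Exchange of source and target

  -- The coslice in the literal form in which it occurs in `Swap₂`, where the opposites of `Σᵗʷ`
  -- meet those on `X` and `Z`.
  Cosliceᵒᵒ : Tm n → Tm n
  Cosliceᵒᵒ a = Σ (𝔸 ᵒ ᵒ) (Hom 𝔸 (a ⁺) x₀ ᵒ ᵒ)

  Cosliceᵒᵒ-/ : (a : Tm m) (σ : Sub Tm m n) → Cosliceᵒᵒ a / σ ≡ Cosliceᵒᵒ (a / σ)
  Cosliceᵒᵒ-/ a σ = cong₂ (λ B C → Σ (B ᵒ ᵒ) (C ᵒ ᵒ)) (closed-/ A σ)
    (cong₂ (λ B a → Hom B a x₀) (closed-/ A (σ ↑)) (⁺-↑ a))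

  SwappedArrow : Tm n
  SwappedArrow = Σ (𝔸 ᵒ) (Cosliceᵒᵒ x₀ ᵒ)

  -- The family handed to `swap`. The earlier variable `x₁` is the target, because `Arrow` lists the
  -- target first.
  Hom-x₀-x₁ : Tm (2 + n)
  Hom-x₀-x₁ = Hom 𝔸 x₀ x₁

  Swap₁-≡ : Swap₁ 𝔸 𝔸 (Hom-x₀-x₁ {n}) ≡ Arrow ᵒ
  Swap₁-≡ = cong (λ B → (Σ 𝔸 (Σᵗʷ B Hom-x₀-x₁)) ᵒ) (closed-⁺ A)

  Swap₂-≡ : Swap₂ 𝔸 𝔸 (Hom-x₀-x₁ {n}) ≡ SwappedArrow
  Swap₂-≡ = cong₂ (λ B C → Σ (𝔸 ᵒ) ((Σ (B ᵒ ᵒ) (Hom C x₁ x₀ ᵒ ᵒ)) ᵒ)) (closed-⁺ A) (closed-/ A _)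

  module _ (⊢Γ : ⊢ Γ) where

    Coslice-≐-ᵒᵒ : Γ ⊢[ std ] a ≐ a′ ∶ 𝔸 ᵒ → Γ ⊢[ std ] a ∶ 𝔸 ᵒ → Γ ⊢[ std ] a′ ∶ 𝔸 ᵒ →
                   Γ ⊢[ std ] Coslice a ≐ Cosliceᵒᵒ a′ type N
    Coslice-≐-ᵒᵒ a≐a′ ⊢a ⊢a′ = ty-trans (Coslice-cong ⊢Γ ⊢a a≐a′)
      (Σ-cong (𝔸-type ⊢Γ) (ty-sym (ᵒ-ᵒ (𝔸-type ⊢Γ)))
        (ty-sym (ᵒ-ᵒ (𝒮et-type (Coslice-Hom ⊢Γ ⊢a′)))))

    Cosliceᵒᵒ-x₀ : Γ ▹ 𝔸 ᵒ ⊢[ std ] Cosliceᵒᵒ x₀ ᵒ type N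
    Cosliceᵒᵒ-x₀ = ty-ᵒ (ty-Σ (ty-ᵒ ⊢𝔸ᵒ)
      (ty-ᵒ (ty-ᵒ (𝒮et-type (Hom-type (▹-ctx (ty-ᵒ ⊢𝔸ᵒ))
        (𝔸ᵒ-cast⁺ (⁺-term (𝔸ᵒ-cast⁺ (tm-var (ty-ᵒ (𝔸-type ⊢Γ)))) (ty-ᵒ ⊢𝔸ᵒ)))
        (tm-conv (ᵒ-ᵒ (𝔸-type (▹-ctx (ty-ᵒ ⊢𝔸ᵒ))))
          (cast (cong (λ B → B ᵒ ᵒ) (closed-⁺ A)) (tm-var (ty-ᵒ ⊢𝔸ᵒ)))))))))
      where
      ⊢𝔸ᵒ = ty-ᵒ (𝔸-type (▹-ctx (ty-ᵒ (𝔸-type ⊢Γ))))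

    Hom-x₀-x₁-type : Γ ▹ 𝔸 ▹ (𝔸 ᵒ) ⁺ ⊢[ std ] Hom-x₀-x₁ type N
    Hom-x₀-x₁-type =
      subst (λ B → Γ ▹ 𝔸 ▹ B ᵒ ⊢[ std ] Hom-x₀-x₁ type N) (sym (closed-⁺ A))
        (𝒮et-type (Slice-Hom (▹-ctx (𝔸-type ⊢Γ)) (𝔸-cast⁺ (tm-var (𝔸-type ⊢Γ)))))

    swap-tm : Γ ⊢[ std ] r ∶ Arrow ᵒ → Γ ⊢[ std ] swap r ∶ SwappedArrow
    swap-tm r = cast Swap₂-≡
      (tm-swap (𝔸-type ⊢Γ) (𝔸-type ⊢Γ) Hom-x₀-x₁-type (cast (sym Swap₁-≡) r))

    swap⁻¹-tm : Γ ⊢[ std ] s ∶ SwappedArrow → Γ ⊢[ std ] swap⁻¹ s ∶ Arrow ᵒ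
    swap⁻¹-tm s = cast Swap₁-≡
      (tm-swap⁻¹ (𝔸-type ⊢Γ) (𝔸-type ⊢Γ) Hom-x₀-x₁-type (cast (sym Swap₂-≡) s))

    swap-≐ : Γ ⊢[ std ] r ≐ r′ ∶ Arrow ᵒ → Γ ⊢[ std ] swap r ≐ swap r′ ∶ SwappedArrow
    swap-≐ r = cast-≐ Swap₂-≡
      (swap-cong (𝔸-type ⊢Γ) (𝔸-type ⊢Γ) Hom-x₀-x₁-type (cast-≐ (sym Swap₁-≡) r))

    swap⁻¹-≐ : Γ ⊢[ std ] s ≐ s′ ∶ SwappedArrow → Γ ⊢[ std ] swap⁻¹ s ≐ swap⁻¹ s′ ∶ Arrow ᵒ
    swap⁻¹-≐ s = cast-≐ Swap₁-≡
      (swap⁻¹-cong (𝔸-type ⊢Γ) (𝔸-type ⊢Γ) Hom-x₀-x₁-type (cast-≐ (sym Swap₂-≡) s))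

    swap⁻¹-swap-≐ : Γ ⊢[ std ] r ∶ Arrow ᵒ → Γ ⊢[ std ] swap⁻¹ (swap r) ≐ r ∶ Arrow ᵒ
    swap⁻¹-swap-≐ r = cast-≐ Swap₁-≡
      (swap⁻¹-swap (𝔸-type ⊢Γ) (𝔸-type ⊢Γ) Hom-x₀-x₁-type (cast (sym Swap₁-≡) r))

    swap-swap⁻¹-≐ : Γ ⊢[ std ] s ∶ SwappedArrow → Γ ⊢[ std ] swap (swap⁻¹ s) ≐ s ∶ SwappedArrow
    swap-swap⁻¹-≐ s = cast-≐ Swap₂-≡
      (swap-swap⁻¹ (𝔸-type ⊢Γ) (𝔸-type ⊢Γ) Hom-x₀-x₁-type (cast (sym Swap₂-≡) s))

    swap-fst : Γ ⊢[ std ] r ∶ Arrow ᵒ → Γ ⊢[ std ] fst (snd r) ∶ 𝔸 ᵒ →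
               Γ ⊢[ std ] fst (swap r) ≐ fst (snd r) ∶ 𝔸 ᵒ
    swap-fst r = swap-y (𝔸-type ⊢Γ) (𝔸-type ⊢Γ) Hom-x₀-x₁-type (cast (sym Swap₁-≡) r)

    swap-fst-snd : Γ ⊢[ std ] r ∶ Arrow ᵒ → Γ ⊢[ std ] fst (snd (swap r)) ≐ fst r ∶ 𝔸 ᵒ
    swap-fst-snd r = swap-x (𝔸-type ⊢Γ) (𝔸-type ⊢Γ) Hom-x₀-x₁-type (cast (sym Swap₁-≡) r)

    module _ (⊢s : Γ ⊢[ std ] s ∶ SwappedArrow) (⊢a : Γ ⊢[ std ] a ∶ 𝔸 ᵒ)
             (fst≐a : Γ ⊢[ std ] fst s ≐ a ∶ 𝔸 ᵒ) where

      private
        Coslice-fst : Γ ⊢[ std ] Cosliceᵒᵒ (fst s) ᵒ ≐ Coslice a ᵒ type N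
        Coslice-fst = ty-sym (ᵒ-cong (Coslice-≐-ᵒᵒ (tm-≐-sym fst≐a) ⊢a (tm-fst ⊢s)))

      snd-Swapped : Γ ⊢[ std ] snd s ∶ Coslice a ᵒ
      snd-Swapped = tm-conv Coslice-fst (cast (cong _ᵒ (Cosliceᵒᵒ-/ x₀ _)) (tm-snd ⊢s))

      snd-Swapped-cong : Γ ⊢[ std ] s ≐ s′ ∶ SwappedArrow →
                         Γ ⊢[ std ] snd s ≐ snd s′ ∶ Coslice a ᵒ
      snd-Swapped-cong s≐s′ =
        tm-conv Coslice-fst (cast-≐ (cong _ᵒ (Cosliceᵒᵒ-/ x₀ _)) (snd-cong s≐s′))

    module _ (⊢a : Γ ⊢[ std ] a ∶ 𝔸 ᵒ) (⊢q : Γ ⊢[ std ] q ∶ Coslice a ᵒ) where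

      private
        ⊢q′ : Γ ⊢[ std ] q ∶ (Cosliceᵒᵒ x₀ ᵒ) / sub a
        ⊢q′ = cast (cong _ᵒ (sym (Cosliceᵒᵒ-/ x₀ (sub a))))
          (tm-conv (ᵒ-cong (Coslice-≐-ᵒᵒ (tm-≐-refl ⊢a) ⊢a ⊢a)) ⊢q)

      pair-Swapped : Γ ⊢[ std ] pair a q ∶ SwappedArrow
      pair-Swapped = tm-pair Cosliceᵒᵒ-x₀ ⊢a ⊢q′

      fst-pair-Swapped : Γ ⊢[ std ] fst (pair a q) ≐ a ∶ 𝔸 ᵒ
      fst-pair-Swapped = Σ-β₁ Cosliceᵒᵒ-x₀ ⊢a ⊢q′

      snd-pair-Swapped : Γ ⊢[ std ] snd (pair a q) ≐ q ∶ Coslice a ᵒ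
      snd-pair-Swapped = tm-conv
        (ty-sym (ᵒ-cong (Coslice-≐-ᵒᵒ (tm-≐-refl ⊢a) ⊢a ⊢a)))
        (cast-≐ (cong _ᵒ (Cosliceᵒᵒ-/ x₀ (sub a))) (Σ-β₂ Cosliceᵒᵒ-x₀ ⊢a ⊢q′))

    pair-fst-Swapped : Γ ⊢[ std ] s ∶ SwappedArrow → Γ ⊢[ std ] a ≐ fst s ∶ 𝔸 ᵒ →
                       Γ ⊢[ std ] a ∶ 𝔸 ᵒ →
                       Γ ⊢[ std ] pair a (snd s) ≐ s ∶ SwappedArrow
    pair-fst-Swapped {s = s} {a = a} ⊢s a≐fst ⊢a = tm-≐-trans
      (pair-cong Cosliceᵒᵒ-x₀ a≐fst
        (cast-≐ (cong _ᵒ (sym (Cosliceᵒᵒ-/ x₀ (sub a))))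
          (tm-≐-refl (tm-conv (ᵒ-cong (Coslice-≐-ᵒᵒ (tm-≐-refl ⊢a) ⊢a ⊢a))
            (snd-Swapped ⊢s ⊢a (tm-≐-sym a≐fst))))))
      (Σ-η ⊢s)

  Arrow-closed : closed (Arrow {0}) ≡ Arrow {n}
  Arrow-closed = Arrow-/ []

  -- For an arrow r in Γ, out r is r as a term of (Coslice (dom r))ᵒᵖ in Γᵒᵖ, and
  -- into is the inverse passage.
  out : Tm n → Tm n
  out r = snd (swap r)

  into : Tm n → Tm n → Tm n
  into a q = swap⁻¹ (pair a q)

  module _ (⊢Γ : ⊢ Γ) where

    private
      ⊢Γᵒᵖ = ᵒᵖ-ctx ⊢Γ
      ⊢◇Arrow = Arrow-type ◇-ctx

    Arrow-ᵒᵖ : Γ ⊢[ std ] r ∶ Arrow → Γ ᵒᵖ ⊢[ std ] r ∶ Arrow ᵒ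
    Arrow-ᵒᵖ r = cast (cong _ᵒ Arrow-closed) (closed-ᵒᵖ ⊢◇Arrow ⊢Γ (cast (sym Arrow-closed) r))

    Arrow-ᵒᵖ-≐ : Γ ⊢[ std ] r ≐ r′ ∶ Arrow → Γ ᵒᵖ ⊢[ std ] r ≐ r′ ∶ Arrow ᵒ
    Arrow-ᵒᵖ-≐ r = cast-≐ (cong _ᵒ Arrow-closed)
      (closed-ᵒᵖ-≐ ⊢◇Arrow ⊢Γ (cast-≐ (sym Arrow-closed) r))

    Arrow-ᵒᵖ⁻¹ : Γ ᵒᵖ ⊢[ std ] r ∶ Arrow ᵒ → Γ ⊢[ std ] r ∶ Arrow
    Arrow-ᵒᵖ⁻¹ r = cast Arrow-closed
      (closed-ᵒᵖ⁻¹ ⊢◇Arrow ⊢Γ (cast (cong _ᵒ (sym Arrow-closed)) r))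

    Arrow-ᵒᵖ⁻¹-≐ : Γ ᵒᵖ ⊢[ std ] r ≐ r′ ∶ Arrow ᵒ → Γ ⊢[ std ] r ≐ r′ ∶ Arrow
    Arrow-ᵒᵖ⁻¹-≐ r =
      cast-≐ Arrow-closed (closed-ᵒᵖ⁻¹-≐ ⊢◇Arrow ⊢Γ (cast-≐ (cong _ᵒ (sym Arrow-closed)) r))

    module _ (⊢r : Γ ⊢[ std ] r ∶ Arrow) (⊢a : Γ ⊢[ std ] a ∶ 𝔸)
             (dom≐a : Γ ⊢[ std ] dom r ≐ a ∶ 𝔸) where

      private
        ⊢aᵒ = closed-ᵒᵖ ⊢A ⊢Γ ⊢a
        fst-swap : Γ ᵒᵖ ⊢[ std ] fst (swap r) ≐ a ∶ 𝔸 ᵒ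
        fst-swap = tm-≐-trans
          -- In `Γ ᵒᵖ` the component `snd r` of `r : Arrow ᵒ` is merely displayed, so the source is
          -- formed in `Γ` and then moved across. This supplies the extra premise of `swap-y`.
          (swap-fst ⊢Γᵒᵖ (Arrow-ᵒᵖ ⊢r) (closed-ᵒᵖ ⊢A ⊢Γ (dom-tm ⊢Γ ⊢r)))
          (closed-ᵒᵖ-≐ ⊢A ⊢Γ dom≐a)

      out-tm : Γ ᵒᵖ ⊢[ std ] out r ∶ Coslice a ᵒ
      out-tm = snd-Swapped ⊢Γᵒᵖ (swap-tm ⊢Γᵒᵖ (Arrow-ᵒᵖ ⊢r)) ⊢aᵒ fst-swap

      out-cong : Γ ⊢[ std ] r ≐ r′ ∶ Arrow → Γ ᵒᵖ ⊢[ std ] out r ≐ out r′ ∶ Coslice a ᵒ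
      out-cong r≐r′ = snd-Swapped-cong ⊢Γᵒᵖ (swap-tm ⊢Γᵒᵖ (Arrow-ᵒᵖ ⊢r)) ⊢aᵒ fst-swap
        (swap-≐ ⊢Γᵒᵖ (Arrow-ᵒᵖ-≐ r≐r′))

      -- `out` drops the source and `into` puts `a` in its place. By `dom≐a` this is the source that
      -- `swap` records, so η for Σ and then the inverse law of `swap` apply.
      into-out : Γ ⊢[ std ] into a (out r) ≐ r ∶ Arrow
      into-out = Arrow-ᵒᵖ⁻¹-≐ (tm-≐-trans
        (swap⁻¹-≐ ⊢Γᵒᵖ
          (pair-fst-Swapped ⊢Γᵒᵖ (swap-tm ⊢Γᵒᵖ (Arrow-ᵒᵖ ⊢r)) (tm-≐-sym fst-swap) ⊢aᵒ))
        (swap⁻¹-swap-≐ ⊢Γᵒᵖ (Arrow-ᵒᵖ ⊢r)))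

    fst-out : Γ ⊢[ std ] r ∶ Arrow → Γ ⊢[ std ] fst (out r) ≐ cod r ∶ 𝔸
    fst-out ⊢r = closed-ᵒᵖ⁻¹-≐ ⊢A ⊢Γ (swap-fst-snd ⊢Γᵒᵖ (Arrow-ᵒᵖ ⊢r))

    module _ (⊢a : Γ ⊢[ std ] a ∶ 𝔸) (⊢q : Γ ᵒᵖ ⊢[ std ] q ∶ Coslice a ᵒ) where

      private
        ⊢aᵒ = closed-ᵒᵖ ⊢A ⊢Γ ⊢a
        ⊢pair = pair-Swapped ⊢Γᵒᵖ ⊢aᵒ ⊢q
        ⊢intoᵒ = swap⁻¹-tm ⊢Γᵒᵖ ⊢pair
        swap-into = swap-swap⁻¹-≐ ⊢Γᵒᵖ ⊢pair

        fst-swap : Γ ᵒᵖ ⊢[ std ] fst (swap (into a q)) ≐ a ∶ 𝔸 ᵒ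
        fst-swap = tm-≐-trans (fst-cong swap-into) (fst-pair-Swapped ⊢Γᵒᵖ ⊢aᵒ ⊢q)

      into-tm : Γ ⊢[ std ] into a q ∶ Arrow
      into-tm = Arrow-ᵒᵖ⁻¹ ⊢intoᵒ

      out-into : Γ ᵒᵖ ⊢[ std ] out (into a q) ≐ q ∶ Coslice a ᵒ
      out-into = tm-≐-trans
        (snd-Swapped-cong ⊢Γᵒᵖ (swap-tm ⊢Γᵒᵖ ⊢intoᵒ) ⊢aᵒ fst-swap swap-into)
        (snd-pair-Swapped ⊢Γᵒᵖ ⊢aᵒ ⊢q)

      dom-into : Γ ⊢[ std ] dom (into a q) ≐ a ∶ 𝔸
      dom-into = closed-ᵒᵖ⁻¹-≐ ⊢A ⊢Γ (tm-≐-trans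
        (tm-≐-sym (swap-fst ⊢Γᵒᵖ ⊢intoᵒ (closed-ᵒᵖ ⊢A ⊢Γ (dom-tm ⊢Γ into-tm))))
        fst-swap)

      -- By `swap-x` the target of an arrow can be read off from its `out`, and the `out` of
      -- `into a q` is `q`.
      cod-into : Γ ⊢[ std ] cod (into a q) ≐ fst q ∶ 𝔸
      cod-into = tm-≐-trans (tm-≐-sym (fst-out into-tm))
        (closed-ᵒᵖ⁻¹-≐ ⊢A ⊢Γ (fstᵒ-cong out-into))

  -- Elimination into families over a discrete type

  Homᵗʷ-/ : (a b : Tm m) (σ : Sub Tm m n) → Homᵗʷ 𝔸 a b / σ ≡ Homᵗʷ 𝔸 (a / σ) (b / σ)
  Homᵗʷ-/ a b σ = cong₂ (λ B b → tw (Hom B x₀ b) (a / σ))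
    (trans (⁺-↑ 𝔸) (cong _⁺ (closed-/ A σ))) (⁺-↑ b)

  Homᵗʷ-⁺ : (a b : Tm n) → Homᵗʷ 𝔸 a b ⁺ ≡ Homᵗʷ 𝔸 (a ⁺) (b ⁺)
  Homᵗʷ-⁺ a b = trans (sym (/-wk (Homᵗʷ 𝔸 a b)))
    (trans (Homᵗʷ-/ a b wk) (cong₂ (Homᵗʷ 𝔸) (/-wk a) (/-wk b)))

  Homᵗʷ-type : ⊢ Γ → Γ ⊢[ std ] a ∶ 𝔸 → Γ ⊢[ std ] b ∶ 𝔸 → Γ ⊢[ dsp ] Homᵗʷ 𝔸 a b type N
  Homᵗʷ-type {Γ = Γ} {a = a} {b = b} ⊢Γ ⊢a ⊢b =
    subst (λ B → Γ ⊢[ dsp ] tw (Hom B x₀ (b ⁺)) a type N) (sym (closed-⁺ A))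
      (ty-tw (𝔸-type ⊢Γ) (𝒮et-type (Slice-Hom ⊢Γ ⊢b)) ⊢a)

  module _ {n} {Γ : Ctx n} {X : Tm (suc n)} (⊢Γ : ⊢ Γ) (⊢X : Γ ▹ 𝔸 ⊢[ std ] X ∶ 𝒮et N) where

    private
      Γ₃ = Γ ▹ 𝔸 ▹ 𝔸 ⁺ ▹ᵈ Homᵗʷ (𝔸 ⁺ ⁺) x₀ x₁
      ⊢𝔸 = 𝔸-type ⊢Γ
      ⊢Γ₁ = ▹-ctx ⊢𝔸
      ⊢𝔸⁺ = ⁺-type ⊢𝔸 ⊢𝔸
      ⊢Γ₂ = ▹-ctx ⊢𝔸⁺

      𝔸⁺⁺ : 𝔸 {n} ⁺ ⁺ ≡ 𝔸
      𝔸⁺⁺ = trans (cong _⁺ (closed-⁺ A)) (closed-⁺ A)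

      ⊢x₀ : Γ ▹ 𝔸 ▹ 𝔸 ⁺ ⊢[ std ] x₀ ∶ 𝔸
      ⊢x₀ = cast 𝔸⁺⁺ (tm-var ⊢𝔸⁺)

      ⊢x₁ : Γ ▹ 𝔸 ▹ 𝔸 ⁺ ⊢[ std ] x₁ ∶ 𝔸
      ⊢x₁ = cast 𝔸⁺⁺ (⁺-term (tm-var ⊢𝔸) ⊢𝔸⁺)

      ⊢H : Γ ▹ 𝔸 ▹ 𝔸 ⁺ ⊢[ dsp ] Homᵗʷ (𝔸 ⁺ ⁺) x₀ x₁ type N
      ⊢H = subst (λ B → Γ ▹ 𝔸 ▹ 𝔸 ⁺ ⊢[ dsp ] Homᵗʷ B x₀ x₁ type N) (sym 𝔸⁺⁺)
        (Homᵗʷ-type ⊢Γ₂ ⊢x₀ ⊢x₁)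

      ⇛-wk³ : Γ₃ ⊢ x₁ ∷ wk ⊙ wk ⊙ wk ⇛ Γ ▹ 𝔸
      ⇛-wk³ = ⇛-∷ (⇛-⊙ (⇛-⊙ (⇛-wk ⊢𝔸) (⇛-wk ⊢𝔸⁺)) (⇛-wk ⊢H)) ⊢𝔸
        (cast (trans (closed-⁺ A) (sym (closed-/ A _))) (⁺-term ⊢x₀ ⊢H))

      wk³-∷ : (f a b : Tm m) (σ : Sub Tm n m) →
              (x₁ ∷ wk ⊙ wk ⊙ wk) ⊙ (f ∷ a ∷ b ∷ σ) ≡ a ∷ σ
      wk³-∷ f a b σ = cong (a ∷_)
        (trans (sym L.⊙-assoc) (trans (cong ((wk ⊙ wk) ⊙_) (L.wk-⊙-∷ f (a ∷ b ∷ σ)))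
          (trans (sym L.⊙-assoc) (trans (cong (wk ⊙_) (L.wk-⊙-∷ a (b ∷ σ))) (L.wk-⊙-∷ b σ)))))

      X-wk³ : (f a b : Tm m) (σ : Sub Tm n m) →
              X / (x₁ ∷ wk ⊙ wk ⊙ wk) / (f ∷ a ∷ b ∷ σ) ≡ X / (a ∷ σ)
      X-wk³ f a b σ = trans (sym (/-⊙ X)) (cong (X /_) (wk³-∷ f a b σ))

    MotiveCtx-ctx : ⊢ MotiveCtx Γ 𝔸 X
    MotiveCtx-ctx = ▹-ctx (ty-ᵒ (ty-sub (𝒮et-type ⊢X) ⇛-wk³))

    X-at : Δ ⊢ σ ⇛ Γ → Δ ⊢[ std ] a ∶ 𝔸 → Δ ⊢[ std ] X / (a ∷ σ) ∶ 𝒮et N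
    X-at {σ = σ} ⊢σ ⊢a = tm-sub ⊢X (⇛-∷ ⊢σ ⊢𝔸 (cast (sym (closed-/ A σ)) ⊢a))

    ⇛-Motive : Δ ⊢ σ ⇛ Γ → Δ ⊢[ std ] b ∶ 𝔸 → Δ ⊢[ std ] a ∶ 𝔸 →
               Δ ⊢[ dsp ] f ∶ Homᵗʷ 𝔸 a b → Δ ⊢[ std ] x ∶ (X / (a ∷ σ)) ᵒ →
               Δ ⊢ x ∷ f ∷ a ∷ b ∷ σ ⇛ MotiveCtx Γ 𝔸 X
    ⇛-Motive {σ = σ} {b = b} {a = a} {f = f} ⊢σ ⊢b ⊢a ⊢f ⊢x =
      ⇛-∷ (⇛-∷ (⇛-∷ (⇛-∷ ⊢σ ⊢𝔸 (cast (sym (closed-/ A σ)) ⊢b))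
        ⊢𝔸⁺ (cast (sym (trans (⁺-∷ 𝔸) (closed-/ A σ))) ⊢a))
        ⊢H (cast (sym (trans (cong (λ B → Homᵗʷ B x₀ x₁ / (a ∷ b ∷ σ)) 𝔸⁺⁺)
                               (Homᵗʷ-/ x₀ x₁ (a ∷ b ∷ σ)))) ⊢f))
        (ty-ᵒ (ty-sub (𝒮et-type ⊢X) ⇛-wk³)) (cast (cong _ᵒ (sym (X-wk³ f a b σ))) ⊢x)

    private
      ⊢X₃ = ty-ᵒ (ty-sub (𝒮et-type ⊢X) ⇛-wk³)

    motive-b : MotiveCtx Γ 𝔸 X ⊢[ std ] x₃ ∶ 𝔸
    motive-b = 𝔸-cast⁺ (⁺-term (𝔸-cast⁺ (⁺-term ⊢x₁ ⊢H)) ⊢X₃)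

    motive-a : MotiveCtx Γ 𝔸 X ⊢[ std ] x₂ ∶ 𝔸
    motive-a = 𝔸-cast⁺ (⁺-term (𝔸-cast⁺ (⁺-term ⊢x₀ ⊢H)) ⊢X₃)

    motive-f : MotiveCtx Γ 𝔸 X ⊢[ dsp ] x₁ ∶ Homᵗʷ 𝔸 x₂ x₃
    motive-f = cast (Homᵗʷ-⁺ x₁ x₂) (⁺-term
      (cast (trans (cong (λ B → Homᵗʷ B x₀ x₁ ⁺) 𝔸⁺⁺) (Homᵗʷ-⁺ x₀ x₁)) (tm-var ⊢H)) ⊢X₃)

    motive-x : MotiveCtx Γ 𝔸 X ⊢[ std ] x₀ ∶ (X / (x₁ ∷ wk ⊙ wk ⊙ wk)) ⁺
    motive-x = tm-conv (ᵒ-𝒮et (⁺-term (tm-sub ⊢X ⇛-wk³) ⊢X₃)) (tm-var ⊢X₃)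

    motive-F : Γ ⊢[ std ] F ∶ 𝔽 → MotiveCtx Γ 𝔸 X ⊢[ std ] F ⁺ ⁺ ⁺ ⁺ ∶ 𝔽
    motive-F ⊢F = cast 𝔽-⁺ (⁺-term (cast 𝔽-⁺ (⁺-term (cast 𝔽-⁺ (⁺-term (cast 𝔽-⁺
      (⁺-term ⊢F ⊢𝔸)) ⊢𝔸⁺)) ⊢H)) ⊢X₃)

    module _ {D : Tm (4 + n)} (⊢D : MotiveCtx Γ 𝔸 X ⊢[ std ] D type N) where

      -- X is discrete, so that x̄ is x.
      motiveAt-≐ : ⊢ Δ → Δ ⊢ σ ⇛ Γ → Δ ⊢[ std ] b ∶ 𝔸 → Δ ⊢[ std ] a ∶ 𝔸 →
                   Δ ⊢[ dsp ] f ∶ Homᵗʷ 𝔸 a b → Δ ⊢[ std ] x ∶ X / (a ∷ σ) →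
                   Δ ⊢[ dsp ] motiveAt σ D b a f x ≐ D / (x ∷ f ∷ a ∷ b ∷ σ) type N
      motiveAt-≐ {Δ = Δ} {σ = σ} {b = b} {a = a} {f = f} {x = x} ⊢Δ ⊢σ ⊢b ⊢a ⊢f ⊢x =
        subst (λ D′ → Δ ⊢[ dsp ] motiveAt σ D b a f x ≐ D′ type N)
          (trans (sym (/-⊙ D)) (cong (D /_) sub-x))
          (tw-𝒮et (X-at ⊢σ ⊢a)
            (ty-sub ⊢D (⇛-Motive (⇛-⊙ ⊢σ (⇛-wk ⊢Xᵒ))
              (𝔸-cast⁺ (⁺-term ⊢b ⊢Xᵒ)) (𝔸-cast⁺ (⁺-term ⊢a ⊢Xᵒ))
              (cast (Homᵗʷ-⁺ a b) (⁺-term ⊢f ⊢Xᵒ))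
              (cast (cong _ᵒ X⁺) (tm-var ⊢Xᵒ))))
            ⊢x)
        where
        ⊢Xᵒ = ty-ᵒ (𝒮et-type (X-at ⊢σ ⊢a))

        X⁺ : (X / (a ∷ σ)) ⁺ ≡ X / (a ⁺ ∷ σ ⊙ wk)
        X⁺ = trans (sym (/-wk (X / (a ∷ σ)))) (trans (sym (/-⊙ X))
          (cong (λ a → X / (a ∷ σ ⊙ wk)) (/-wk a)))

        sub-x : (x₀ ∷ f ⁺ ∷ a ⁺ ∷ b ⁺ ∷ σ ⊙ wk) ⊙ sub x ≡ x ∷ f ∷ a ∷ b ∷ σ
        sub-x = cong (x ∷_) (cong₂ _∷_ (⁺-sub f) (cong₂ _∷_ (⁺-sub a) (cong₂ _∷_ (⁺-sub b)
          (trans (sym L.⊙-assoc) (trans (cong (σ ⊙_) L.wk-⊙-sub) L.⊙-id)))))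

      module _ {d : Tm (2 + n)}
               (⊢d : Γ ▹ 𝔸 ▹ X ⊢[ std ] d ∶ D / (x₀ ∷ refl x₁ ∷ x₁ ∷ x₁ ∷ wk ⊙ wk)) where

        private
          ⊢ΓX = ▹-ctx (𝒮et-type ⊢X)

          ⊢wk² : Γ ▹ 𝔸 ▹ X ⊢ wk ⊙ wk ⇛ Γ
          ⊢wk² = ⇛-⊙ (⇛-wk ⊢𝔸) (⇛-wk (𝒮et-type ⊢X))

          ⊢a : Γ ▹ 𝔸 ▹ X ⊢[ std ] x₁ ∶ 𝔸
          ⊢a = cast 𝔸⁺⁺ (⁺-term (tm-var ⊢𝔸) (𝒮et-type ⊢X))

          ⊢refl = tm-refl (𝔸-type ⊢ΓX) ⊢a

          ⊢x : Γ ▹ 𝔸 ▹ X ⊢[ std ] x₀ ∶ X / (x₁ ∷ wk ⊙ wk)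
          ⊢x = cast (trans (sym (/-wk X)) (cong (λ σ → X / (x₁ ∷ σ)) L.map-weaken))
            (tm-var (𝒮et-type ⊢X))

          ⊢d′ : Γ ▹ 𝔸 ▹ X ⊢[ dsp ] d ∶ motiveAt (wk ⊙ wk) D x₁ x₁ (refl x₁) x₀
          ⊢d′ = tm-conv (ty-sym (motiveAt-≐ ⊢ΓX ⊢wk² ⊢a ⊢a ⊢refl ⊢x))
            (std⇒dsp ⊢ΓX
              (ty-sub ⊢D (⇛-Motive ⊢wk² ⊢a ⊢a ⊢refl (ᵒ-term ⊢ΓX (X-at ⊢wk² ⊢a) ⊢x))) ⊢d)

        module _ (⊢b : Γ ⊢[ std ] b ∶ 𝔸) (⊢a : Γ ⊢[ std ] a ∶ 𝔸)
                 (⊢f : Γ ⊢[ dsp ] f ∶ Homᵗʷ 𝔸 a b) (⊢x : Γ ⊢[ std ] x ∶ X / sub a) where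

          private
            ⊢D′ : Γ ⊢[ std ] D / (x ∷ f ∷ a ∷ b ∷ id) type N
            ⊢D′ = ty-sub ⊢D (⇛-Motive (⇛-id ⊢Γ) ⊢b ⊢a ⊢f (ᵒ-term ⊢Γ (X-at (⇛-id ⊢Γ) ⊢a) ⊢x))

            motive = motiveAt-≐ ⊢Γ (⇛-id ⊢Γ) ⊢b ⊢a ⊢f ⊢x

          -- `tm-j` gives a displayed term of a twisted motive. The twist goes because `X` is
          -- discrete, the display because `D` is an ordinary type.
          j-term : Γ ⊢[ std ] j f x d ∶ D / (x ∷ f ∷ a ∷ b ∷ id)
          j-term = dsp⇒std ⊢Γ ⊢D′
            (tm-conv motive (tm-j (𝒮et-type ⊢X) ⊢D ⊢d′ ⊢b ⊢a ⊢f ⊢x))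

          j-term-cong : Γ ⊢[ dsp ] f ≐ f′ ∶ Homᵗʷ 𝔸 a b → Γ ⊢[ std ] x ≐ x′ ∶ X / sub a →
                        Γ ⊢[ std ] j f x d ≐ j f′ x′ d ∶ D / (x ∷ f ∷ a ∷ b ∷ id)
          j-term-cong f≐ x≐ = dsp⇒std-≐ ⊢Γ ⊢D′
            (tm-conv motive (j-cong (𝒮et-type ⊢X) ⊢D (tm-≐-refl ⊢d′) ⊢b ⊢a f≐ x≐))

        j-term-β : Γ ⊢[ std ] a ∶ 𝔸 → Γ ⊢[ std ] x ∶ X / sub a →
                   Γ ⊢[ std ] j (refl a) x d ≐ d / (x ∷ a ∷ id)
                     ∶ D / (x ∷ refl a ∷ a ∷ a ∷ id)
        j-term-β ⊢a ⊢x = dsp⇒std-≐ ⊢Γ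
          (ty-sub ⊢D (⇛-Motive (⇛-id ⊢Γ) ⊢a ⊢a ⊢refl′ (ᵒ-term ⊢Γ (X-at (⇛-id ⊢Γ) ⊢a) ⊢x)))
          (tm-conv (motiveAt-≐ ⊢Γ (⇛-id ⊢Γ) ⊢a ⊢a ⊢refl′ ⊢x)
            (j-β (𝒮et-type ⊢X) ⊢D ⊢d′ ⊢a ⊢x))
          where ⊢refl′ = tm-refl ⊢𝔸 ⊢a

  -- Transport and evaluation

  ⁺⁴-∷ : (F : Tm m) (x f a b : Tm n) (σ : Sub Tm m n) →
         (F ⁺ ⁺ ⁺ ⁺) / (x ∷ f ∷ a ∷ b ∷ σ) ≡ F / σ
  ⁺⁴-∷ F x f a b σ = trans (⁺-∷ (F ⁺ ⁺ ⁺)) (trans (⁺-∷ (F ⁺ ⁺)) (trans (⁺-∷ (F ⁺)) (⁺-∷ F)))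

  ⁺⁴-id : (F : Tm n) (x f a b : Tm n) → (F ⁺ ⁺ ⁺ ⁺) / (x ∷ f ∷ a ∷ b ∷ id) ≡ F
  ⁺⁴-id F x f a b = trans (⁺⁴-∷ F x f a b id) (/-id F)

  wk² : (F : Tm n) → F / (wk ⊙ wk) ≡ F ⁺ ⁺
  wk² F = trans (/-⊙ F) (trans (cong (_/ wk) (/-wk F)) (/-wk (F ⁺)))

  wk³ : (F : Tm n) → F / (wk ⊙ wk ⊙ wk) ≡ F ⁺ ⁺ ⁺
  wk³ F = trans (/-⊙ F) (trans (cong (_/ wk) (wk² F)) (/-wk (F ⁺ ⁺)))

  -- The action of a copresheaf on arrows: the parameter type is `F a`, the motive is `F b`, and the
  -- case of reflexivity returns its parameter.
  transport : Tm n → Tm n → Tm n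
  transport f x = j f x x₀

  module _ (⊢Γ : ⊢ Γ) (⊢F : Γ ⊢[ std ] F ∶ 𝔽) where

    private
      ⊢𝔸 = 𝔸-type ⊢Γ

    ⊢F⁺ : Γ ▹ 𝔸 ⊢[ std ] F ⁺ ∶ 𝔽
    ⊢F⁺ = cast 𝔽-⁺ (⁺-term ⊢F ⊢𝔸)

    ⊢generic : Γ ▹ 𝔸 ⊢[ std ] x₀ ∶ 𝔸
    ⊢generic = 𝔸-cast⁺ (tm-var ⊢𝔸)

    ⊢Fx : Γ ▹ 𝔸 ⊢[ std ] app (F ⁺) x₀ ∶ 𝒮et N
    ⊢Fx = app-F (▹-ctx ⊢𝔸) ⊢F⁺ ⊢generic

    private
      ⊢D : MotiveCtx Γ 𝔸 (app (F ⁺) x₀) ⊢[ std ] app (F ⁺ ⁺ ⁺ ⁺) x₃ type N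
      ⊢D = 𝒮et-type (app-F (MotiveCtx-ctx ⊢Γ ⊢Fx) (motive-F ⊢Γ ⊢Fx ⊢F) (motive-b ⊢Γ ⊢Fx))

      ⊢d : Γ ▹ 𝔸 ▹ app (F ⁺) x₀ ⊢[ std ] x₀ ∶
             app (F ⁺ ⁺ ⁺ ⁺) x₃ / (x₀ ∷ refl x₁ ∷ x₁ ∷ x₁ ∷ wk ⊙ wk)
      ⊢d = cast
        (cong (λ F → app F x₁) (sym (trans (⁺⁴-∷ F x₀ (refl x₁) x₁ x₁ (wk ⊙ wk)) (wk² F))))
        (tm-var (𝒮et-type ⊢Fx))

      Fx-sub : (a : Tm _) → app (F ⁺) x₀ / sub a ≡ app F a
      Fx-sub a = cong (λ F → app F a) (⁺-sub F)

      D-∷ : (x f a b : Tm _) →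
            app (F ⁺ ⁺ ⁺ ⁺) x₃ / (x ∷ f ∷ a ∷ b ∷ id) ≡ app F b
      D-∷ x f a b = cong (λ F → app F b) (⁺⁴-id F x f a b)

    module _ (⊢b : Γ ⊢[ std ] b ∶ 𝔸) (⊢a : Γ ⊢[ std ] a ∶ 𝔸)
             (⊢f : Γ ⊢[ dsp ] f ∶ Homᵗʷ 𝔸 a b) (⊢x : Γ ⊢[ std ] x ∶ app F a) where

      transport-tm : Γ ⊢[ std ] transport f x ∶ app F b
      transport-tm = cast (D-∷ x f a b)
        (j-term ⊢Γ ⊢Fx ⊢D ⊢d ⊢b ⊢a ⊢f (cast (sym (Fx-sub a)) ⊢x))

      transport-cong : Γ ⊢[ dsp ] f ≐ f′ ∶ Homᵗʷ 𝔸 a b → Γ ⊢[ std ] x ≐ x′ ∶ app F a →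
                       Γ ⊢[ std ] transport f x ≐ transport f′ x′ ∶ app F b
      transport-cong f≐ x≐ = cast-≐ (D-∷ x f a b)
        (j-term-cong ⊢Γ ⊢Fx ⊢D ⊢d ⊢b ⊢a ⊢f (cast (sym (Fx-sub a)) ⊢x)
          f≐ (cast-≐ (sym (Fx-sub a)) x≐))

    transport-β : Γ ⊢[ std ] a ∶ 𝔸 → Γ ⊢[ std ] x ∶ app F a →
                  Γ ⊢[ std ] transport (refl a) x ≐ x ∶ app F a
    transport-β {a = a} {x = x} ⊢a ⊢x = cast-≐ (D-∷ x (refl a) a a)
      (j-term-β ⊢Γ ⊢Fx ⊢D ⊢d ⊢a (cast (sym (Fx-sub a)) ⊢x))

  eval : Tm n → Tm n → Tm n
  eval φ a = app φ (out (idArrow a))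

  module _ (⊢Γ : ⊢ Γ) (⊢F : Γ ⊢[ std ] F ∶ 𝔽) where

    module _ (⊢b : Γ ⊢[ std ] b ∶ 𝔸) (⊢a : Γ ⊢[ std ] a ∶ 𝔸)
             (⊢f : Γ ⊢[ dsp ] f ∶ Homᵗʷ 𝔸 a b) (⊢φ : Γ ⊢[ std ] φ ∶ Y F a) where

      app-arrow-tm : Γ ⊢[ std ] app φ (out (arrow b a f)) ∶ app F b
      app-arrow-tm = tm-conv
        (𝒮et-≐-type (app-F-cong ⊢Γ ⊢F (tm-≐-trans (fst-out ⊢Γ ⊢arrow) (cod-β ⊢Γ ⊢b ⊢a ⊢f))))
        (app-Y {a = a} ⊢φ (out-tm ⊢Γ ⊢arrow ⊢a (dom-β ⊢Γ ⊢b ⊢a ⊢f)))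
        where ⊢arrow = arrow-tm ⊢Γ ⊢b ⊢a ⊢f

    eval-tm : Γ ⊢[ std ] a ∶ 𝔸 → Γ ⊢[ std ] φ ∶ Y F a → Γ ⊢[ std ] eval φ a ∶ app F a
    eval-tm ⊢a ⊢φ = app-arrow-tm ⊢a ⊢a (tm-refl (𝔸-type ⊢Γ) ⊢a) ⊢φ

  -- The naturality square of `φ` along `f`, evaluated at the identity of `a` and with the composite
  -- of `f` and the identity already replaced by `f`. The direction of the `Hom` is the one required
  -- of `t`.
  Naturality : Tm n → Tm n → Tm n → Tm n → Tm n → Tm n
  Naturality F b a f φ =
    Hom (app F b) (app φ (out (arrow b a f))) (transport f (eval φ a))

  module _ (⊢Γ : ⊢ Γ) (⊢F : Γ ⊢[ std ] F ∶ 𝔽) where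

    Naturality-type : Γ ⊢[ std ] b ∶ 𝔸 → Γ ⊢[ std ] a ∶ 𝔸 → Γ ⊢[ dsp ] f ∶ Homᵗʷ 𝔸 a b →
                      Γ ⊢[ std ] φ ∶ Y F a → Γ ⊢[ std ] Naturality F b a f φ type N
    Naturality-type ⊢b ⊢a ⊢f ⊢φ = 𝒮et-type (Hom-𝒮et ⊢Γ (app-F ⊢Γ ⊢F ⊢b)
      (app-arrow-tm ⊢Γ ⊢F ⊢b ⊢a ⊢f ⊢φ)
      (transport-tm ⊢Γ ⊢F ⊢b ⊢a ⊢f (eval-tm ⊢Γ ⊢F ⊢a ⊢φ)))

    -- At the identity both ends are `eval φ a`: the left one by definition of `idArrow`, the right
    -- one by `transport-β`.
    eval-natural : Γ ⊢[ std ] a ∶ 𝔸 → Γ ⊢[ std ] φ ∶ Y F a →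
                   Γ ⊢[ std ] refl (eval φ a) ∶ Naturality F a a (refl a) φ
    eval-natural ⊢a ⊢φ = tm-conv
      (𝒮et-≐-type (Hom-cong (ty-refl (𝒮et-type ⊢Fa))
        (tm-≐-refl (ᵒ-term ⊢Γ ⊢Fa (eval-tm ⊢Γ ⊢F ⊢a ⊢φ)))
        (tm-≐-sym (transport-β ⊢Γ ⊢F ⊢a (eval-tm ⊢Γ ⊢F ⊢a ⊢φ)))))
      (refl-discrete ⊢Γ ⊢Fa (eval-tm ⊢Γ ⊢F ⊢a ⊢φ))
      where ⊢Fa = app-F ⊢Γ ⊢F ⊢a

  module _ {n} {Γ : Ctx n} {F : Tm n} (⊢Γ : ⊢ Γ) (⊢F : Γ ⊢[ std ] F ∶ 𝔽) where
    private
      ⊢𝔸 = 𝔸-type ⊢Γ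
      ⊢Γ₁ = ▹-ctx ⊢𝔸

      X : Tm (suc n)
      X = Y (F ⁺) x₀

      ⊢X : Γ ▹ 𝔸 ⊢[ std ] X ∶ 𝒮et N
      ⊢X = Y-𝒮et ⊢Γ₁ (⊢F⁺ ⊢Γ ⊢F) (⊢generic ⊢Γ ⊢F)

      D : Tm (4 + n)
      D = Naturality (F ⁺ ⁺ ⁺ ⁺) x₃ x₂ x₁ x₀

      X-wk³≡ : (X / (x₁ ∷ wk ⊙ wk ⊙ wk)) ⁺ ≡ Y (F ⁺ ⁺ ⁺ ⁺) x₂
      X-wk³≡ = trans (cong _⁺ (trans (Y-/ (F ⁺) x₀ _)
        (cong (λ F → Y F x₁) (trans (⁺-∷ F) (wk³ F))))) (Y-⁺ (F ⁺ ⁺ ⁺) x₁)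

      ⊢D : MotiveCtx Γ 𝔸 X ⊢[ std ] D type N
      ⊢D = Naturality-type (MotiveCtx-ctx ⊢Γ ⊢X) (motive-F ⊢Γ ⊢X ⊢F)
        (motive-b ⊢Γ ⊢X) (motive-a ⊢Γ ⊢X) (motive-f ⊢Γ ⊢X)
        (cast X-wk³≡ (motive-x ⊢Γ ⊢X))

      D-∷ : {x f a b : Tm m} {σ : Sub Tm n m} →
            D / (x ∷ f ∷ a ∷ b ∷ σ) ≡ Naturality (F / σ) b a f x
      D-∷ {x = x} {f} {a} {b} {σ} = cong (λ F → Naturality F b a f x) (⁺⁴-∷ F x f a b σ)

      ⊢ΓX = ▹-ctx (𝒮et-type ⊢X)

      ⊢d : Γ ▹ 𝔸 ▹ X ⊢[ std ] refl (eval x₀ x₁) ∶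
             D / (x₀ ∷ refl x₁ ∷ x₁ ∷ x₁ ∷ wk ⊙ wk)
      ⊢d = cast (sym (trans D-∷ (cong (λ F → Naturality F x₁ x₁ (refl x₁) x₀) (wk² F))))
        (eval-natural ⊢ΓX
          (cast 𝔽-⁺ (⁺-term (⊢F⁺ ⊢Γ ⊢F) (𝒮et-type ⊢X)))
          (𝔸-cast⁺ (⁺-term (⊢generic ⊢Γ ⊢F) (𝒮et-type ⊢X)))
          (cast (Y-⁺ (F ⁺) x₀) (tm-var (𝒮et-type ⊢X))))

    -- The parameter of `j` is `φ` itself, with `Y(F,a)` as the type `X` over the source `a`; only
    -- so does `φ` specialise along with `f`.
    naturality : Γ ⊢[ std ] b ∶ 𝔸 → Γ ⊢[ std ] a ∶ 𝔸 → Γ ⊢[ dsp ] f ∶ Homᵗʷ 𝔸 a b →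
                 Γ ⊢[ std ] φ ∶ Y F a →
                 Γ ⊢[ std ] j f φ (refl (eval x₀ x₁)) ∶ Naturality F b a f φ
    naturality {b = b} {a = a} {f = f} {φ = φ} ⊢b ⊢a ⊢f ⊢φ =
      cast (trans D-∷ (cong (λ F → Naturality F b a f φ) (/-id F)))
        (j-term ⊢Γ ⊢X ⊢D ⊢d ⊢b ⊢a ⊢f
          (cast (sym (trans (Y-/ (F ⁺) x₀ (sub a)) (cong (λ F → Y F a) (⁺-sub F)))) ⊢φ))

  -- Coevaluation and the comparison of `φ` with its reconstruction

  along : Tm n → Tm n → Tm n → Tm n
  along a q y = transport (hom (into a q)) y

  -- The natural transformation (x, f) ↦ F(f)(y).
  coeval : Tm n → Tm n → Tm n
  coeval a y = lam (along (a ⁺) x₀ (y ⁺))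

  coeval-/ : (a y : Tm m) (σ : Sub Tm m n) → coeval a y / σ ≡ coeval (a / σ) (y / σ)
  coeval-/ a y σ = cong₂ (λ a y → lam (along a x₀ y)) (⁺-↑ a) (⁺-↑ y)

  coeval-⁺ : (a y : Tm n) → coeval a y ⁺ ≡ coeval (a ⁺) (y ⁺)
  coeval-⁺ a y = trans (sym (/-wk (coeval a y)))
    (trans (coeval-/ a y wk) (cong₂ coeval (/-wk a) (/-wk y)))

  module _ (⊢Γ : ⊢ Γ) (⊢F : Γ ⊢[ std ] F ∶ 𝔽) (⊢a : Γ ⊢[ std ] a ∶ 𝔸) where

    module _ (⊢φ : Γ ⊢[ std ] φ ∶ Y F a) where

      app-out-cong : Γ ⊢[ std ] r ∶ Arrow → Γ ⊢[ std ] dom r ≐ a ∶ 𝔸 →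
                     Γ ᵒᵖ ⊢[ std ] out r ≐ q ∶ Coslice a ᵒ →
                     Γ ⊢[ std ] cod r ≐ b ∶ 𝔸 →
                     Γ ⊢[ std ] app φ (out r) ≐ app φ q ∶ app F b
      app-out-cong ⊢r dom≐a out≐q cod≐b = tm-conv
        (𝒮et-≐-type (app-F-cong ⊢Γ ⊢F (tm-≐-trans (fst-out ⊢Γ ⊢r) cod≐b)))
        (app-Y-cong {a = a} (tm-≐-refl ⊢φ) out≐q)

      -- Elimination yields the value of `φ` at the identity of `dom r`, while `coeval` is fed the
      -- value at the identity of `a`; this reconciles them.
      eval-cong : Γ ⊢[ std ] a ≐ a′ ∶ 𝔸 → Γ ⊢[ std ] eval φ a ≐ eval φ a′ ∶ app F a
      eval-cong a≐a′ = app-out-cong ⊢i (dom-β ⊢Γ ⊢a ⊢a ⊢refl)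
        (out-cong ⊢Γ ⊢i ⊢a (dom-β ⊢Γ ⊢a ⊢a ⊢refl) (idArrow-cong ⊢Γ a≐a′))
        (cod-β ⊢Γ ⊢a ⊢a ⊢refl)
        where
        ⊢i    = idArrow-tm ⊢Γ ⊢a
        ⊢refl = tm-refl (𝔸-type ⊢Γ) ⊢a

    module _ (⊢y : Γ ⊢[ std ] y ∶ app F a) where

      private
        at : Γ ⊢[ std ] a ≐ b ∶ 𝔸 → Γ ⊢[ std ] y ∶ app F b
        at a≐b = tm-conv (𝒮et-≐-type (app-F-cong ⊢Γ ⊢F a≐b)) ⊢y

      -- The source of `into a q` is `a` and its target `fst q` only up to judgemental equality, so
      -- both the input `y` and the result are converted.
      along-tm : Γ ᵒᵖ ⊢[ std ] q ∶ Coslice a ᵒ → Γ ⊢[ std ] along a q y ∶ app F (fst q)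
      along-tm ⊢q = tm-conv (𝒮et-≐-type (app-F-cong ⊢Γ ⊢F (cod-into ⊢Γ ⊢a ⊢q)))
        (transport-tm ⊢Γ ⊢F (cod-tm ⊢Γ ⊢r) (dom-tm ⊢Γ ⊢r) (hom-tm ⊢Γ ⊢r)
          (at (tm-≐-sym (dom-into ⊢Γ ⊢a ⊢q))))
        where ⊢r = into-tm ⊢Γ ⊢a ⊢q

      -- By `into-out` the transport is along the arrow component of `idArrow a`, which is `refl a`.
      along-id : Γ ⊢[ std ] along a (out (idArrow a)) y ≐ y ∶ app F a
      along-id = tm-≐-trans
        (tm-conv (𝒮et-≐-type (app-F-cong ⊢Γ ⊢F cod≐a))
          (transport-cong ⊢Γ ⊢F (cod-tm ⊢Γ ⊢r) (dom-tm ⊢Γ ⊢r) (hom-tm ⊢Γ ⊢r)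
            (at (tm-≐-sym dom≐a))
            (tm-≐-trans (hom-cong ⊢Γ ⊢r r≐i)
              (tm-conv (ty-sym (Homᵗʷ-cong ⊢Γ (cod-tm ⊢Γ ⊢r) dom≐a cod≐a))
                (hom-β ⊢Γ ⊢a ⊢a ⊢refl)))
            (tm-≐-refl (at (tm-≐-sym dom≐a)))))
        (transport-β ⊢Γ ⊢F ⊢a ⊢y)
        where
        ⊢refl = tm-refl (𝔸-type ⊢Γ) ⊢a
        ⊢i    = idArrow-tm ⊢Γ ⊢a
        dom-i = dom-β ⊢Γ ⊢a ⊢a ⊢refl
        ⊢r    = into-tm ⊢Γ ⊢a (out-tm ⊢Γ ⊢i ⊢a dom-i)
        r≐i   = into-out ⊢Γ ⊢i ⊢a dom-i
        dom≐a = tm-≐-trans (dom-cong ⊢Γ ⊢r r≐i) dom-i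
        cod≐a = tm-≐-trans (fst-cong r≐i) (cod-β ⊢Γ ⊢a ⊢a ⊢refl)

  module _ (⊢Γ : ⊢ Γ) (⊢F : Γ ⊢[ std ] F ∶ 𝔽) (⊢a : Γ ⊢[ std ] a ∶ 𝔸)
           (⊢y : Γ ⊢[ std ] y ∶ app F a) where

    private
      ⊢body : Γ ▹⁻ Coslice a ⊢[ std ] along (a ⁺) x₀ (y ⁺) ∶ app (F ⁺) (fst x₀)
      ⊢body = along-tm (⊢Γ▹⁻ ⊢Γ ⊢F ⊢a) (F⁺ ⊢Γ ⊢F ⊢a) (a⁺ ⊢Γ ⊢F ⊢a)
        (wk-term (⇛-wk-Coslice ⊢Γ ⊢F ⊢a) ⊢y) (q-var ⊢Γ ⊢F ⊢a)

    coeval-tm : Γ ⊢[ std ] coeval a y ∶ Y F a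
    coeval-tm = tm-lam (Coslice⁻ ⊢Γ ⊢F ⊢a) ⊢body

    coeval-β : Γ ᵒᵖ ⊢[ std ] q ∶ Coslice a ᵒ →
               Γ ⊢[ std ] app (coeval a y) q ≐ along a q y ∶ app F (fst q)
    coeval-β {q = q} ⊢q =
      subst (λ t → Γ ⊢[ std ] app (coeval a y) q ≐ t ∶ app F (fst q))
        (cong₂ (λ a y → along a q y) (⁺-sub a) (⁺-sub y))
        (cast-≐ (app-Y-≡ F q) (Π-β (Coslice⁻ ⊢Γ ⊢F ⊢a) ⊢body ⊢q))

    eval-coeval : Γ ⊢[ std ] eval (coeval a y) a ≐ y ∶ app F a
    eval-coeval = tm-≐-trans
      (tm-conv (𝒮et-≐-type (app-F-cong ⊢Γ ⊢F
          (tm-≐-trans (fst-out ⊢Γ ⊢i) (cod-β ⊢Γ ⊢a ⊢a ⊢refl))))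
        (coeval-β (out-tm ⊢Γ ⊢i ⊢a (dom-β ⊢Γ ⊢a ⊢a ⊢refl))))
      (along-id ⊢Γ ⊢F ⊢a ⊢y)
      where
      ⊢refl = tm-refl (𝔸-type ⊢Γ) ⊢a
      ⊢i    = idArrow-tm ⊢Γ ⊢a

  module _ (⊢Γ : ⊢ Γ) (⊢F : Γ ⊢[ std ] F ∶ 𝔽) (⊢a : Γ ⊢[ std ] a ∶ 𝔸)
           (⊢φ : Γ ⊢[ std ] φ ∶ Y F a) where

    module _ (⊢q : Γ ᵒᵖ ⊢[ std ] q ∶ Coslice a ᵒ) where

      private
        ⊢r    = into-tm ⊢Γ ⊢a ⊢q
        ⊢b    = cod-tm ⊢Γ ⊢r
        ⊢d    = dom-tm ⊢Γ ⊢r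
        ⊢f    = hom-tm ⊢Γ ⊢r
        cod≐  = cod-into ⊢Γ ⊢a ⊢q
        dom≐a = dom-into ⊢Γ ⊢a ⊢q
        -- `j` needs `φ` over the actual source `dom r` of the arrow.
        ⊢φ′   = tm-conv (Y-cong ⊢Γ ⊢F ⊢a (tm-≐-sym dom≐a)) ⊢φ
        ⊢arr  = arrow-tm ⊢Γ ⊢b ⊢d ⊢f
        η     = arrow-η ⊢Γ ⊢r
        dom-arr = tm-≐-trans (dom-β ⊢Γ ⊢b ⊢d ⊢f) dom≐a

        Fcod≐ = 𝒮et-≐-type (app-F-cong ⊢Γ ⊢F cod≐)

      -- This is `naturality` for the components of `r = into a q`, with its ends rewritten. On the
      -- left, `arrow-η` reassembles `r` and `out-into` returns `q`; on the right, the transport is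
      -- the β-reduct of `coeval` at `q`.
      naturality-at : Γ ⊢[ std ] j (hom (into a q)) φ (refl (eval x₀ x₁)) ∶
                        Hom (app F (fst q)) (app φ q) (app (coeval a (eval φ a)) q)
      naturality-at = tm-conv
        (𝒮et-≐-type (Hom-cong Fcod≐
          (ᵒ-term-≐ ⊢Γ (app-F ⊢Γ ⊢F ⊢b)
            (app-out-cong ⊢Γ ⊢F ⊢a ⊢φ ⊢arr dom-arr
              (tm-≐-trans (out-cong ⊢Γ ⊢arr ⊢a dom-arr η) (out-into ⊢Γ ⊢a ⊢q))
              (cod-β ⊢Γ ⊢b ⊢d ⊢f)))
          (tm-≐-trans
            (transport-cong ⊢Γ ⊢F ⊢b ⊢d ⊢f (eval-tm ⊢Γ ⊢F ⊢d ⊢φ′) (tm-≐-refl ⊢f)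
              (eval-cong ⊢Γ ⊢F ⊢d ⊢φ′ dom≐a))
            (tm-conv (ty-sym Fcod≐)
              (tm-≐-sym (coeval-β ⊢Γ ⊢F ⊢a (eval-tm ⊢Γ ⊢F ⊢a ⊢φ) ⊢q))))))
        (naturality ⊢Γ ⊢F ⊢b ⊢d ⊢f ⊢φ′)

  unit : Tm n → Tm n → Tm n
  unit a φ = funext (j (hom (into (a ⁺) x₀)) (φ ⁺) (refl (eval x₀ x₁)))

  module _ (⊢Γ : ⊢ Γ) (⊢F : Γ ⊢[ std ] F ∶ 𝔽) (⊢a : Γ ⊢[ std ] a ∶ 𝔸)
           (⊢φ : Γ ⊢[ std ] φ ∶ Y F a) where

    private
      ⊢Γ′ = ⊢Γ▹⁻ ⊢Γ ⊢F ⊢a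
      ⊢q = q-var ⊢Γ ⊢F ⊢a
      ⊢φ⁺ = cast (Y-⁺ F a) (wk-term (⇛-wk-Coslice ⊢Γ ⊢F ⊢a) ⊢φ)
      ⊢ψ = coeval-tm ⊢Γ ⊢F ⊢a (eval-tm ⊢Γ ⊢F ⊢a ⊢φ)
      ⊢ψ⁺ = cast (Y-⁺ F a) (wk-term (⇛-wk-Coslice ⊢Γ ⊢F ⊢a) ⊢ψ)

    -- `funext` takes and returns terms of twisted `Hom`. Pointwise the type is a value of `F` and
    -- globally it is `Y F a`; both are discrete, so both twists can be removed.
    unit-tm : Γ ⊢[ std ] unit a φ ∶ Hom (Y F a) φ (coeval a (eval φ a))
    unit-tm = Homᵗʷ⇒Hom ⊢Γ (Y-𝒮et ⊢Γ ⊢F ⊢a) ⊢φ ⊢ψ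
      (tm-funext (Coslice⁻ ⊢Γ ⊢F ⊢a) (𝒮et-type (F-q ⊢Γ ⊢F ⊢a)) ⊢φ ⊢ψ
        (Hom⇒Homᵗʷ ⊢Γ′ (F-q ⊢Γ ⊢F ⊢a)
          (app-Y {a = a ⁺} ⊢φ⁺ ⊢q) (app-Y {a = a ⁺} ⊢ψ⁺ ⊢q)
          (cast
            (cong (λ ψ → Hom (app (F ⁺) (fst x₀)) (app (φ ⁺) x₀) (app ψ x₀))
              (sym (coeval-⁺ a (eval φ a))))
            (naturality-at ⊢Γ′ (F⁺ ⊢Γ ⊢F ⊢a) (a⁺ ⊢Γ ⊢F ⊢a) ⊢φ⁺ ⊢q))))

  -- Families over (A → Set) × A

  Domain : Tm n
  Domain = Σ 𝔽 𝔸

  Ξ : Ctx 2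
  Ξ = ◇ ▹ 𝔽 ▹ 𝔸

  ⊢Ξ : ⊢ Ξ
  ⊢Ξ = ▹-ctx (𝔸-type (▹-ctx (𝔽-type ◇-ctx)))

  module _ (⊢Γ : ⊢ Γ) where

    private
      ⊢Γ𝔽 = ▹-ctx (𝔽-type ⊢Γ)

    Dom-type : Γ ⊢[ std ] Domain type N
    Dom-type = ty-Σ (𝔽-type ⊢Γ) (𝔸-type ⊢Γ𝔽)

    ⇛-Ξ-≐ : Γ ⊢[ std ] F ≐ F′ ∶ 𝔽 → Γ ⊢[ std ] a ≐ a′ ∶ 𝔸 → Γ ⊢ a ∷ F ∷ [] ≐ a′ ∷ F′ ∷ [] ⇛ Ξ
    ⇛-Ξ-≐ F≐ a≐ = ∷-cong
      (∷-cong (sub-refl (⇛-[] ⊢Γ)) (𝔽-type ◇-ctx) (cast-≐ (sym 𝔽-closed) F≐))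
      (𝔸-type (▹-ctx (𝔽-type ◇-ctx))) (cast-≐ (sym (closed-/ A _)) a≐)

    ⇛-Ξ : Γ ⊢[ std ] F ∶ 𝔽 → Γ ⊢[ std ] a ∶ 𝔸 → Γ ⊢ a ∷ F ∷ [] ⇛ Ξ
    ⇛-Ξ F a = ⇛-∷
      (⇛-∷ (⇛-[] ⊢Γ) (𝔽-type ◇-ctx) (cast (sym 𝔽-closed) F))
      (𝔸-type (▹-ctx (𝔽-type ◇-ctx))) (cast (sym (closed-/ A _)) a)

    module _ (⊢F : Γ ⊢[ std ] F ∶ 𝔽) (⊢a : Γ ⊢[ std ] a ∶ 𝔸) where

      private
        ⊢a′ : Γ ⊢[ std ] a ∶ 𝔸 / sub F
        ⊢a′ = cast (sym (closed-/ A (sub F))) ⊢a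

      pair-Dom : Γ ⊢[ std ] pair F a ∶ Domain
      pair-Dom = tm-pair (𝔸-type ⊢Γ𝔽) ⊢F ⊢a′

      fst-pair-Dom : Γ ⊢[ std ] fst (pair F a) ≐ F ∶ 𝔽
      fst-pair-Dom = Σ-β₁ (𝔸-type ⊢Γ𝔽) ⊢F ⊢a′

      snd-pair-Dom : Γ ⊢[ std ] snd (pair F a) ≐ a ∶ 𝔸
      snd-pair-Dom = cast-≐ (closed-/ A (sub F)) (Σ-β₂ (𝔸-type ⊢Γ𝔽) ⊢F ⊢a′)

    snd-Dom : Γ ⊢[ std ] t ∶ Domain → Γ ⊢[ std ] snd t ∶ 𝔸
    snd-Dom t = cast (closed-/ A _) (tm-snd t)

    snd-Dom-cong : Γ ⊢[ std ] t ≐ t′ ∶ Domain → Γ ⊢[ std ] snd t ≐ snd t′ ∶ 𝔸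
    snd-Dom-cong t = cast-≐ (closed-/ A _) (snd-cong t)

  Domain-/ : (σ : Sub Tm m n) → Domain / σ ≡ Domain
  Domain-/ σ = cong₂ (λ B C → Σ (Π B (𝒮et ℓ)) C) (closed-/ A σ) (closed-/ A (σ ↑))

  -- Turns a term over separate variables `F`, `a`, `w` into a closed function on the nested Σ-type,
  -- as `Nat` demands. `Φ` and `Ψ` are the two instances.
  module Uncurried {W : Tm 2} (⊢W : Ξ ⊢[ std ] W type N) where

    Total : Tm n
    Total = Σ Domain (W / (snd x₀ ∷ fst x₀ ∷ []))

    Total-/ : (σ : Sub Tm m n) → Total / σ ≡ Total
    Total-/ σ = cong₂ Σ (Domain-/ σ) (sym (/-⊙ W))

    W-at : Tm n → Tm n → Tm n
    W-at F a = W / (a ∷ F ∷ [])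

    private
      W-sub : (t : Tm n) → W / (snd x₀ ∷ fst x₀ ∷ []) / sub t ≡ W-at (fst t) (snd t)
      W-sub t = sym (/-⊙ W)

    module _ (⊢Γ : ⊢ Γ) where

      W-type : Γ ▹ Domain ⊢[ std ] W / (snd x₀ ∷ fst x₀ ∷ []) type N
      W-type = ty-sub ⊢W (⇛-Ξ ⊢Γ′ (tm-fst ⊢x₀) (snd-Dom ⊢Γ′ ⊢x₀))
        where
        ⊢Γ′ = ▹-ctx (Dom-type ⊢Γ)
        ⊢x₀ = cast (trans (sym (/-wk Domain)) (Domain-/ wk)) (tm-var (Dom-type ⊢Γ))

      Total-type : Γ ⊢[ std ] Total type N
      Total-type = ty-Σ (Dom-type ⊢Γ) W-type

      module _ (⊢F : Γ ⊢[ std ] F ∶ 𝔽) (⊢a : Γ ⊢[ std ] a ∶ 𝔸) where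

        private
          ⊢p = pair-Dom ⊢Γ ⊢F ⊢a

          W-≐ : Γ ⊢[ std ] W-at F a ≐ W-at (fst (pair F a)) (snd (pair F a)) type N
          W-≐ = ty-sub (ty-refl ⊢W) (⇛-Ξ-≐ ⊢Γ (tm-≐-sym (fst-pair-Dom ⊢Γ ⊢F ⊢a))
            (tm-≐-sym (snd-pair-Dom ⊢Γ ⊢F ⊢a)))

        module _ (⊢w : Γ ⊢[ std ] v ∶ W-at F a) where

          private
            ⊢w′ : Γ ⊢[ std ] v ∶ W / (snd x₀ ∷ fst x₀ ∷ []) / sub (pair F a)
            ⊢w′ = cast (sym (W-sub (pair F a))) (tm-conv W-≐ ⊢w)

            fst-≐ : Γ ⊢[ std ] pair F a ≐ fst (pair (pair F a) v) ∶ Domain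
            fst-≐ = tm-≐-sym (Σ-β₁ W-type ⊢p ⊢w′)

          pair-Total : Γ ⊢[ std ] pair (pair F a) v ∶ Total
          pair-Total = tm-pair W-type ⊢p ⊢w′

          F-≐ : Γ ⊢[ std ] F ≐ fst (fst (pair (pair F a) v)) ∶ 𝔽
          F-≐ = tm-≐-trans (tm-≐-sym (fst-pair-Dom ⊢Γ ⊢F ⊢a)) (fst-cong fst-≐)

          a-≐ : Γ ⊢[ std ] a ≐ snd (fst (pair (pair F a) v)) ∶ 𝔸
          a-≐ = tm-≐-trans (tm-≐-sym (snd-pair-Dom ⊢Γ ⊢F ⊢a)) (snd-Dom-cong ⊢Γ fst-≐)

          v-≐ : Γ ⊢[ std ] v ≐ snd (pair (pair F a) v) ∶ W-at F a
          v-≐ = tm-conv (ty-sym W-≐)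
            (cast-≐ (W-sub (pair F a)) (tm-≐-sym (Σ-β₂ W-type ⊢p ⊢w′)))

    module _ {R : Tm 2} (⊢R : Ξ ⊢[ std ] R type N) {e : Tm 3} (⊢e : Ξ ▹ W ⊢[ std ] e ∶ R ⁺) where

      uncurried : Tm 0
      uncurried = lam (e / (snd x₀ ∷ snd (fst x₀) ∷ fst (fst x₀) ∷ []))

      private
        R′ : Tm 1
        R′ = R / (snd (fst x₀) ∷ fst (fst x₀) ∷ [])

        ⊢Total = Total-type ◇-ctx

        ⊢body : ◇ ▹ Total ⊢[ std ] e / (snd x₀ ∷ snd (fst x₀) ∷ fst (fst x₀) ∷ []) ∶ R′
        ⊢body = cast (⁺-∷ R) (tm-sub ⊢e
          (⇛-∷ (⇛-Ξ ⊢Γ (tm-fst (tm-fst ⊢x₀)) (snd-Dom ⊢Γ (tm-fst ⊢x₀))) ⊢W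
            (cast (sym (/-⊙ W)) (tm-snd ⊢x₀))))
          where
          ⊢Γ  = ▹-ctx ⊢Total
          ⊢x₀ = cast (trans (sym (/-wk Total)) (Total-/ wk)) (tm-var ⊢Total)

      uncurried-tm : ◇ ⊢[ std ] uncurried ∶ Π Total R′
      uncurried-tm = lam-closed ⊢Total ⊢body

      module _ (⊢Γ : ⊢ Γ) (⊢F : Γ ⊢[ std ] F ∶ 𝔽) (⊢a : Γ ⊢[ std ] a ∶ 𝔸)
               (⊢v : Γ ⊢[ std ] v ∶ W-at F a) where

        private
          ⊢P : Γ ⊢[ std ] pair (pair F a) v ∶ closed Total
          ⊢P = cast (sym (Total-/ [])) (pair-Total ⊢Γ ⊢F ⊢a ⊢v)

          R-≐ : Γ ⊢[ std ] R′ / (pair (pair F a) v ∷ []) ≐ R / (a ∷ F ∷ []) type N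
          R-≐ = subst (λ B → Γ ⊢[ std ] B ≐ R / (a ∷ F ∷ []) type N) (/-⊙ R)
            (ty-sym (ty-sub (ty-refl ⊢R)
              (⇛-Ξ-≐ ⊢Γ (F-≐ ⊢Γ ⊢F ⊢a ⊢v) (a-≐ ⊢Γ ⊢F ⊢a ⊢v))))

        uncurried-at : Γ ⊢[ std ] closed uncurried at pair F a , v ∶ R / (a ∷ F ∷ [])
        uncurried-at = tm-conv R-≐ (app-closed ⊢Total ⊢body ⊢Γ ⊢P)

        -- The argument is replaced by an equal `v′` in the same step, so that a composite of `Φ`
        -- and `Ψ` unfolds by two uses, the inner one supplying `v ≐ v′` for the outer.
        uncurried-β : Γ ⊢[ std ] v ≐ v′ ∶ W-at F a →
                      Γ ⊢[ std ] closed uncurried at pair F a , v ≐ e / (v′ ∷ a ∷ F ∷ [])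
                        ∶ R / (a ∷ F ∷ [])
        uncurried-β v≐v′ = tm-≐-trans
          (tm-conv R-≐ (β-closed ⊢Total ⊢body ⊢Γ ⊢P))
          (subst (λ t → Γ ⊢[ std ] t ≐ e / _ ∶ R / (a ∷ F ∷ [])) (/-⊙ e)
            (cast-≐ (⁺-∷ R)
              (tm-≐-sym (tm-sub (⁺-type ⊢R ⊢W) (tm-≐-refl ⊢e)
                (∷-cong (⇛-Ξ-≐ ⊢Γ (F-≐ ⊢Γ ⊢F ⊢a ⊢v) (a-≐ ⊢Γ ⊢F ⊢a ⊢v)) ⊢W
                  (tm-≐-trans (tm-≐-sym v≐v′) (v-≐ ⊢Γ ⊢F ⊢a ⊢v)))))))

  -- The natural isomorphism

  Fa Yo : Tm 2
  Fa = app x₁ x₀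
  Yo = Y x₁ x₀

  module _ {W : Tm 2} (⊢W : Ξ ⊢[ std ] W type i) where

    var-F : Ξ ▹ W ⊢[ std ] x₂ ∶ 𝔽
    var-F = cast 𝔽-⁺ (⁺-term (cast 𝔽-⁺ (⁺-term (cast 𝔽-⁺ (tm-var (𝔽-type ◇-ctx)))
      (𝔸-type (▹-ctx (𝔽-type ◇-ctx))))) ⊢W)

    var-a : Ξ ▹ W ⊢[ std ] x₁ ∶ 𝔸
    var-a = 𝔸-cast⁺ (⁺-term (𝔸-cast⁺ (tm-var (𝔸-type (▹-ctx (𝔽-type ◇-ctx))))) ⊢W)

  private
    ⊢Ξ-F : Ξ ⊢[ std ] x₁ ∶ 𝔽
    ⊢Ξ-F = cast 𝔽-⁺ (⁺-term (cast 𝔽-⁺ (tm-var (𝔽-type ◇-ctx)))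
      (𝔸-type (▹-ctx (𝔽-type ◇-ctx))))

    ⊢Ξ-a : Ξ ⊢[ std ] x₀ ∶ 𝔸
    ⊢Ξ-a = 𝔸-cast⁺ (tm-var (𝔸-type (▹-ctx (𝔽-type ◇-ctx))))

    ⊢Fa : Ξ ⊢[ std ] Fa type N
    ⊢Fa = 𝒮et-type (app-F ⊢Ξ ⊢Ξ-F ⊢Ξ-a)

    ⊢Yo : Ξ ⊢[ std ] Yo type N
    ⊢Yo = Y-type ⊢Ξ ⊢Ξ-F ⊢Ξ-a

    ⊢ΞFa = ▹-ctx ⊢Fa
    ⊢ΞYo = ▹-ctx ⊢Yo

    ⊢y : Ξ ▹ Fa ⊢[ std ] x₀ ∶ app x₂ x₁
    ⊢y = tm-var ⊢Fa

    ⊢φ : Ξ ▹ Yo ⊢[ std ] x₀ ∶ Y x₂ x₁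
    ⊢φ = cast (Y-⁺ x₁ x₀) (tm-var ⊢Yo)

    module Φ = Uncurried ⊢Yo
    module Ψ = Uncurried ⊢Fa

    ⊢eval : Ξ ▹ Yo ⊢[ std ] eval x₀ x₁ ∶ Fa ⁺
    ⊢eval = eval-tm ⊢ΞYo (var-F ⊢Yo) (var-a ⊢Yo) ⊢φ

    ⊢coeval : Ξ ▹ Fa ⊢[ std ] coeval x₁ x₀ ∶ Yo ⁺
    ⊢coeval = cast (sym (Y-⁺ x₁ x₀)) (coeval-tm ⊢ΞFa (var-F ⊢Fa) (var-a ⊢Fa) ⊢y)

    Yo-at : (F a : Tm n) → Yo / (a ∷ F ∷ []) ≡ Y F a
    Yo-at F a = Y-/ x₁ x₀ (a ∷ F ∷ [])

  Φ Ψ : Tm 0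
  Φ = Φ.uncurried ⊢Fa ⊢eval
  Ψ = Ψ.uncurried ⊢Yo ⊢coeval

  Φ-tm : ◇ ⊢ Φ ∶ Nat Domain (Yoneda A (fst x₀) (snd x₀)) (Eval A (fst x₀) (snd x₀))
  Φ-tm = cast
    (cong (λ W → Π (Σ Domain W) (app (fst (fst x₀)) (snd (fst x₀)))) (Yo-at (fst x₀) (snd x₀)))
    (Φ.uncurried-tm ⊢Fa ⊢eval)

  Ψ-tm : ◇ ⊢ Ψ ∶ Nat Domain (Eval A (fst x₀) (snd x₀)) (Yoneda A (fst x₀) (snd x₀))
  Ψ-tm = cast
    (cong (Π (Σ Domain (app (fst x₀) (snd x₀))))
      (trans (Yo-at (fst (fst x₀)) (snd (fst x₀))) (sym (Y-/ (fst x₀) (snd x₀) (fst x₀ ∷ [])))))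
    (Ψ.uncurried-tm ⊢Yo ⊢coeval)

  unit-at : Ξ ▹ Yo ⊢ unit x₁ x₀ ∶
    Hom (Y x₂ x₁) x₀ (closed Ψ at pair x₂ x₁ , (closed Φ at pair x₂ x₁ , x₀))
  unit-at = tm-conv
    (𝒮et-≐-type (Hom-cong (ty-refl (Y-type ⊢ΞYo ⊢F ⊢a))
      (tm-≐-refl (ᵒ-term ⊢ΞYo (Y-𝒮et ⊢ΞYo ⊢F ⊢a) ⊢φ))
      (cast-≐ (Yo-at x₂ x₁)
        (tm-≐-sym (Ψ.uncurried-β ⊢Yo ⊢coeval ⊢ΞYo ⊢F ⊢a
          (Φ.uncurried-at ⊢Fa ⊢eval ⊢ΞYo ⊢F ⊢a ⊢φ′)
          (Φ.uncurried-β ⊢Fa ⊢eval ⊢ΞYo ⊢F ⊢a ⊢φ′ (tm-≐-refl ⊢φ′)))))))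
    (unit-tm ⊢ΞYo ⊢F ⊢a ⊢φ)
    where
    ⊢F = var-F ⊢Yo
    ⊢a = var-a ⊢Yo
    ⊢φ′ = cast (sym (Yo-at x₂ x₁)) ⊢φ

  counit-at : Ξ ▹ Fa ⊢ refl x₀ ∶
    Hom (app x₂ x₁) (closed Φ at pair x₂ x₁ , (closed Ψ at pair x₂ x₁ , x₀)) x₀
  counit-at = tm-conv
    (𝒮et-≐-type (Hom-cong (ty-refl (𝒮et-type ⊢Fa′))
      (ᵒ-term-≐ ⊢ΞFa ⊢Fa′ (tm-≐-sym (tm-≐-trans
        (Φ.uncurried-β ⊢Fa ⊢eval ⊢ΞFa ⊢F ⊢a
          (Ψ.uncurried-at ⊢Yo ⊢coeval ⊢ΞFa ⊢F ⊢a ⊢y)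
          (Ψ.uncurried-β ⊢Yo ⊢coeval ⊢ΞFa ⊢F ⊢a ⊢y (tm-≐-refl ⊢y)))
        (eval-coeval ⊢ΞFa ⊢F ⊢a ⊢y))))
      (tm-≐-refl ⊢y)))
    (refl-discrete ⊢ΞFa ⊢Fa′ ⊢y)
    where
    ⊢F = var-F ⊢Fa
    ⊢a = var-a ⊢Fa
    ⊢Fa′ = app-F ⊢ΞFa ⊢F ⊢a

lemma50 : (i ℓ : ℕ) (A : Tm 0) → ◇ ⊢ A ∶ 𝒰 i →
    ∃[ Φ ] ∃[ Ψ ] ∃[ t ] ∃[ s ]
    (◇ ⊢ Φ ∶ Nat (Dom A ℓ) (Yoneda A (fst x₀) (snd x₀)) (Eval A (fst x₀) (snd x₀)))
    × (◇ ⊢ Ψ ∶ Nat (Dom A ℓ) (Eval A (fst x₀) (snd x₀)) (Yoneda A (fst x₀) (snd x₀)))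
    × (◇ ▹ (A ⇒ 𝒮et ℓ) ▹ closed A ▹ Yoneda A x₁ x₀
    ⊢ t ∶ Hom (Yoneda A x₂ x₁) x₀
    (closed Ψ at pair x₂ x₁ , (closed Φ at pair x₂ x₁ , x₀)))
    × (◇ ▹ (A ⇒ 𝒮et ℓ) ▹ closed A ▹ Eval A x₁ x₀
    ⊢ s ∶ Hom (Eval A x₂ x₁)
    (closed Φ at pair x₂ x₁ , (closed Ψ at pair x₂ x₁ , x₀)) x₀)
lemma50 i ℓ A ⊢A = Φ , Ψ , unit x₁ x₀ , refl x₀
  , subst (λ D → ◇ ⊢ Φ ∶ Nat D (Yoneda A (fst x₀) (snd x₀)) (Eval A (fst x₀) (snd x₀)))
      Domain-≡ Φ-tm
  , subst (λ D → ◇ ⊢ Ψ ∶ Nat D (Eval A (fst x₀) (snd x₀)) (Yoneda A (fst x₀) (snd x₀)))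
      Domain-≡ Ψ-tm
  , in-context (Yoneda A x₁ x₀) unit-at
  , in-context (Eval A x₁ x₀) counit-at
  where
  -- The least size that accommodates both `A`, of size `i`, and `𝒮et ℓ`, of size `suc ℓ`.
  open Copresheaves A {i ⊔ suc ℓ} (m≤n⊔m i (suc ℓ)) (ty-lift (m≤m⊔n i (suc ℓ)) (ty-El ⊢A))

  -- In the empty context `closed A` is `A` under the identity substitution, and `closed A` over one
  -- variable is a weakening of `A`; neither holds by computation for a variable `A`.
  Domain-≡ : Domain ≡ Dom A ℓ
  Domain-≡ = cong₂ (λ B C → Σ (Π B (𝒮et ℓ)) C) (/-id A) (/-wk A)

  in-context : (W : Tm 2) {t B : Tm 3} →
               Ξ ▹ W ⊢ t ∶ B → ◇ ▹ (A ⇒ 𝒮et ℓ) ▹ closed A ▹ W ⊢ t ∶ B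
  in-context W {t} {B} = subst (λ A′ → ◇ ▹ (A′ ⇒ 𝒮et ℓ) ▹ closed A ▹ W ⊢ t ∶ B) (/-id A)
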